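{- The satisfiability problem of $\mathrm{GRA}(p,I,\neg,J,\exists)$ is $\Pi_1^0$-complete.
   Context: AD-relations. $A^0=\{\epsilon\}$, with $\epsilon$ the empty tuple. A $k$-ary AD-relation over a set $A$ is a pair $(R,k)$ with $R\subseteq A^k$, $k\ge 0$; $t\in(R,k)$ means $t\in R$. Vocabularies contain only relation symbols (of any arity $k\ge 0$, countably infinitely many available for each arity). Models have nonempty (possibly infinite) domains; $A$ is the domain of $\mathfrak{A}$. Terms. $\mathrm{GRA}(p,I,\neg,J,\exists)$ is the set of terms built from relation symbols by the unary operators $p,I,\neg,\exists$ and the binary operator $J$. Each term $\mathcal{T}$ defines in each model $\mathfrak{A}$ an AD-relation $\mathcal{T}^{\mathfrak{A}}$ of arity $\mathit{ar}(\mathcal{T})$. Let $k=\mathit{ar}(\mathcal{T})$, $\ell=\mathit{ar}(\mathcal{S})$. - $R^{\mathfrak{A}}$ is the interpretation of $R$, paired with the arity of $R$. - If $k\ge2$: $(p\mathcal{T})^{\mathfrak{A}}=(\{(a_k,a_1,\dots,a_{k-1})\mid(a_1,\dots,a_k)\in\mathcal{T}^{\mathfrak{A}}\},k)$ and $(I\mathcal{T})^{\mathfrak{A}}=(\{(a_1,\dots,a_{k-1})\mid(a_1,\dots,a_k)\in\mathcal{T}^{\mathfrak{A}},\ a_{k-1}=a_k\},k-1)$; if $k\le1$ both equal $\mathcal{T}^{\mathfrak{A}}$. - $(\neg\mathcal{T})^{\mathfrak{A}}=(\{t\in A^k\mid t\notin\mathcal{T}^{\mathfrak{A}}\},k)$.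 - $(J(\mathcal{T},\mathcal{S}))^{\mathfrak{A}}=(\{(a_1,\dots,a_k,b_1,\dots,b_\ell)\mid(a_1,\dots,a_k)\in\mathcal{T}^{\mathfrak{A}},(b_1,\dots,b_\ell)\in\mathcal{S}^{\mathfrak{A}}\},k+\ell)$. - If $k\ge1$: $(\exists\mathcal{T})^{\mathfrak{A}}=(\{(a_1,\dots,a_{k-1})\mid(a_1,\dots,a_k)\in\mathcal{T}^{\mathfrak{A}}\text{ for some }a_k\in A\},k-1)$; if $k=0$: $(\exists\mathcal{T})^{\mathfrak{A}}=\mathcal{T}^{\mathfrak{A}}$. Satisfiability problem for a set $\mathcal{G}$ of terms: on input $\mathcal{T}\in\mathcal{G}$, answer yes iff there exists a model $\mathfrak{A}$ such that $\mathcal{T}^{\mathfrak{A}}$ is not the empty AD-relation $(\varnothing,\mathit{ar}(\mathcal{T}))$. -}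

module Defs where

open import Data.Fin.Base using (Fin; toℕ)
open import Data.Nat.Base using (ℕ; zero; suc; pred; _+_; _*_)
open import Data.Product.Base using (∃; ∃-syntax; ∃₂; _×_)
open import Data.Sum.Base using (_⊎_)
open import Data.Vec.Base using (Vec; []; _∷_; _∷ʳ_; _++_; head; last; lookup)
open import Function.Base using (_∘_)
open import Function.Bundles using (_⇔_)
open import Level using (Level; 0ℓ; _⊔_) renaming (suc to lsuc)
open import Relation.Binary.PropositionalEquality.Core using (_≡_)
open import Relation.Nullary.Negation.Core using (¬_)
open import Relation.Unary using (Pred; _∈_; _∉_; ∁; ∅; _≐_)

-- The arity of an AD-relation is carried by its type, so that the empty
-- relations of different arities are different objects.

AD : Set → ℕ → Set₁
AD A k = Pred (Vec A k) 0ℓ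

arI : ℕ → ℕ
arI 0             = 0
arI 1             = 1
arI (suc (suc k)) = suc k

module _ {A : Set} where

  pᴿ : ∀ {k} → AD A k → AD A k
  pᴿ {0}           R = R
  pᴿ {1}           R = R
  pᴿ {suc (suc _)} R (a ∷ as) = (as ∷ʳ a) ∈ R

  Iᴿ : ∀ {k} → AD A k → AD A (arI k)
  Iᴿ {0}           R = R
  Iᴿ {1}           R = R
  Iᴿ {suc (suc _)} R t = ∃[ a ] ((t ∷ʳ a) ∈ R × last t ≡ a)

  ¬ᴿ : ∀ {k} → AD A k → AD A k
  ¬ᴿ R = ∁ R

  Jᴿ : ∀ {k l} → AD A k → AD A l → AD A (k + l)
  Jᴿ R S t = ∃₂ λ as bs → t ≡ as ++ bs × as ∈ R × bs ∈ S

  ∃ᴿ : ∀ {k} → AD A k → AD A (pred k)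
  ∃ᴿ {0}     R = R
  ∃ᴿ {suc _} R t = ∃[ a ] (t ∷ʳ a) ∈ R

-- `rel k i` is the i-th relation symbol of arity k.

data Term : Set where
  rel : (k i : ℕ) → Term
  p′  : Term → Term
  I′  : Term → Term
  ¬′  : Term → Term
  J′  : Term → Term → Term
  ∃′  : Term → Term

ar : Term → ℕ
ar (rel k i) = k
ar (p′ T)    = ar T
ar (I′ T)    = arI (ar T)
ar (¬′ T)    = ar T
ar (J′ T S)  = ar T + ar S
ar (∃′ T)    = pred (ar T)

-- Models interpret every relation symbol; those not occurring in a term have
-- no influence on its value.

record Model : Set₁ where
  field
    Dom     : Set
    element : Dom
    interp  : (k i : ℕ) → AD Dom k

module _ (𝔄 : Model) where
  open Model 𝔄

  ⟦_⟧ : (T : Term) → AD Dom (ar T)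
  ⟦ rel k i ⟧ = interp k i
  ⟦ p′ T ⟧    = pᴿ ⟦ T ⟧
  ⟦ I′ T ⟧    = Iᴿ ⟦ T ⟧
  ⟦ ¬′ T ⟧    = ¬ᴿ ⟦ T ⟧
  ⟦ J′ T S ⟧  = Jᴿ ⟦ T ⟧ ⟦ S ⟧
  ⟦ ∃′ T ⟧    = ∃ᴿ ⟦ T ⟧

Satisfiable : Term → Set₁
Satisfiable T = ∃[ 𝔄 ] ¬ (⟦_⟧ 𝔄 T ≐ ∅)

-- Codes of μ-recursive functions. The recursion or search variable is the first
-- argument; in `prec g h` the step h receives x, the value at x, and the rest.

data Rec : ℕ → Set where
  zer  : Rec 0
  succ : Rec 1
  proj : ∀ {n} → Fin n → Rec n
  comp : ∀ {m n} → Rec m → Vec (Rec n) m → Rec n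
  prec : ∀ {n} → Rec n → Rec (suc (suc n)) → Rec (suc n)
  mu   : ∀ {n} → Rec (suc n) → Rec n

infix 4 _[_]⇓_ _≤ₘ_

-- c [ xs ]⇓ y: the partial function c is defined at xs, with value y.

data _[_]⇓_ : ∀ {n} → Rec n → Vec ℕ n → ℕ → Set where
  zer⇓       : zer [ [] ]⇓ 0
  succ⇓      : ∀ {x} → succ [ x ∷ [] ]⇓ suc x
  proj⇓      : ∀ {n} {xs : Vec ℕ n} i → proj i [ xs ]⇓ lookup xs i
  comp⇓      : ∀ {m n} {f : Rec m} {gs : Vec (Rec n) m} {xs : Vec ℕ n} {y}
               (zs : Vec ℕ m) →
               (∀ i → lookup gs i [ xs ]⇓ lookup zs i) →
               f [ zs ]⇓ y →
               comp f gs [ xs ]⇓ y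
  prec-zero⇓ : ∀ {n} {g : Rec n} {h} {xs : Vec ℕ n} {y} →
               g [ xs ]⇓ y →
               prec g h [ 0 ∷ xs ]⇓ y
  prec-suc⇓  : ∀ {n} {g : Rec n} {h} {xs : Vec ℕ n} {x r y} →
               prec g h [ x ∷ xs ]⇓ r →
               h [ x ∷ r ∷ xs ]⇓ y →
               prec g h [ suc x ∷ xs ]⇓ y
  -- f must be defined, with a nonzero value, at all arguments below y.
  mu⇓        : ∀ {n} {f : Rec (suc n)} {xs : Vec ℕ n} {y}
               (v : Fin y → ℕ) →
               (∀ i → f [ toℕ i ∷ xs ]⇓ suc (v i)) →
               f [ y ∷ xs ]⇓ 0 →
               mu f [ xs ]⇓ y

Computable : ∀ {n} → (Vec ℕ n → ℕ) → Set
Computable {n} f = ∃[ c ] (∀ (xs : Vec ℕ n) → c [ xs ]⇓ f xs)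

ComputableRel : ∀ {n} → Pred (Vec ℕ n) 0ℓ → Set
ComputableRel R =
  ∃[ χ ] (Computable χ × (∀ xs → (χ xs ≡ 1 × xs ∈ R) ⊎ (χ xs ≡ 0 × xs ∉ R)))

private variable
  a b : Level

Π₁⁰ : Pred ℕ a → Set (lsuc 0ℓ ⊔ a)
Π₁⁰ A = ∃[ R ] (ComputableRel R × (∀ n → n ∈ A ⇔ (∀ m → (n ∷ m ∷ []) ∈ R)))

_≤ₘ_ : Pred ℕ a → Pred ℕ b → Set (a ⊔ b)
A ≤ₘ B =
  ∃ λ (f : ℕ → ℕ) → Computable {1} (f ∘ head) × (∀ n → n ∈ A ⇔ f n ∈ B)

Π₁⁰-Complete : Pred ℕ a → Set (lsuc a)
Π₁⁰-Complete {a} A = Π₁⁰ A × (∀ (B : Pred ℕ a) → Π₁⁰ B → B ≤ₘ A)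

-- Cantor's bijection ℕ × ℕ → ℕ.

triangle : ℕ → ℕ
triangle zero    = 0
triangle (suc n) = suc n + triangle n

pair : ℕ → ℕ → ℕ
pair x y = triangle (x + y) + y

-- A Gödel numbering of terms. It is a bijection Term → ℕ: the residue modulo
-- 6 determines the outermost constructor, and codes of subterms are smaller.

⌜_⌝ : Term → ℕ
⌜ rel k i ⌝ = 6 * pair k i
⌜ p′ T ⌝    = 1 + 6 * ⌜ T ⌝
⌜ I′ T ⌝    = 2 + 6 * ⌜ T ⌝
⌜ ¬′ T ⌝    = 3 + 6 * ⌜ T ⌝
⌜ J′ T S ⌝  = 4 + 6 * pair ⌜ T ⌝ ⌜ S ⌝
⌜ ∃′ T ⌝    = 5 + 6 * ⌜ T ⌝

SAT : Pred ℕ (lsuc 0ℓ)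
SAT n = ∃[ T ] (⌜ T ⌝ ≡ n × Satisfiable T)

{-# OPTIONS --safe #-}

-- Membership. Equality does not occur in these terms (I only substitutes), so a term is
-- satisfiable iff a propositional theory over the variables "the term with code n holds of
-- the tuple r of natural numbers" is, in which n and r also name the Henkin witness of an
-- existential statement. Consistency of its first m clauses is decidable, and is the matrix
-- of the Π₁⁰ definition; compactness turns consistency for all m into a model. The logic
-- being constructive, that model has undecidable relations and satisfies the theory up to
-- double negation, which suffices because satisfiability is a negated statement.
--
-- Hardness. For a μ-recursive characteristic function c there are Horn axioms over binary
-- relations, built from composition, intersection and converse, whose least model on ℕ is
-- the graph of c. Together with the axiom that c takes the value 0 at no (n , m) they are
-- satisfiable iff c [ n ∷ m ∷ [] ]⇓ 0 for no m. Argument lists are coded by single elements,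
-- which is what makes binary relations enough and removes the need for swaps.

module Submission where

open import Data.Bool.Base using (Bool; true; false)
open import Data.Empty using (⊥; ⊥-elim)
open import Data.Fin.Base using (Fin; zero; suc; toℕ; fromℕ<)
open import Data.Fin.Properties using (toℕ<n; toℕ-fromℕ<)
import Data.List.Base as List
open import Data.List.Base using (List; []; _∷_; length)
open import Data.List.Relation.Unary.All using (All; []; _∷_)
open import Data.List.Relation.Unary.All.Properties using (++⁺; ++⁻ˡ; ++⁻ʳ)
open import Data.Nat.Base
open import Data.Nat.DivMod using (_%_; _/_; m≡m%n+[m/n]*n; m%n≡m∸m/n*n; [m+kn]%n≡m%n; m%n<n; m<n⇒m%n≡m; m/n<m)
open import Data.Nat.Induction using (<-rec)
open import Data.Nat.Properties
open import Data.Product.Base using (∃; ∃-syntax; ∃₂; _×_; _,_; proj₁; proj₂)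
open import Data.Sum.Base using (_⊎_; inj₁; inj₂)
open import Data.Unit.Base using (⊤; tt)
open import Data.Vec.Base using (Vec; []; _∷_; _∷ʳ_; _++_; head; tail; last; lookup; tabulate; initLast)
open import Data.Vec.Properties using (last-∷ʳ; lookup∘tabulate; ∷ʳ-injective; ++-injective)
open import Function.Base using (_∘_; id; const)
open import Function.Bundles using (_⇔_; mk⇔; Equivalence)
open import Relation.Binary.Definitions using (tri<; tri≈; tri>)
open import Relation.Binary.PropositionalEquality hiding (J)
open import Relation.Nullary.Decidable.Core using (Dec; yes; no; decidable-stable)
open import Relation.Nullary.Negation.Core using (¬_; contradiction; ¬¬-map)
open import Relation.Unary using (Pred; _≐_; ∅)

open import Defs

open Equivalence using (to; from)

-- Membership: numbers are interpreted in a given model one Henkin witness at a time. This is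
-- well-founded because `pair` dominates its arguments, so the parameters of a statement are smaller
-- than its own number. Choosing witnesses and fixing truth values takes excluded middle, so each
-- finite stage exists only up to double negation; decidability of the matrix then removes it.
--
-- Hardness: without equality the axioms cannot make `S`, `hd` or `tl` functional, nor give a number
-- a unique representative. They bound the relations from below instead: each Horn axiom is an
-- inclusion, so every derivation of `c [ xs ]⇓ y` has a copy in every model, and the emptiness of
-- the query is the axiom that forbids a value. Fullness of `one` does two jobs: it provides a list
-- for every head and tail, and it makes `one` the universal relation, so that `R ⨾ Z ˘ ⨾ one` tests
-- whether `R` has a value that is zero.

triangle-≥ : ∀ n → n ≤ triangle n
triangle-≥ zero    = z≤n
triangle-≥ (suc n) = m≤m+n (suc n) (triangle n)

+≤pair : ∀ x y → x + y ≤ pair x y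
+≤pair x y = ≤-trans (triangle-≥ (x + y)) (m≤m+n _ y)

left≤pair : ∀ x y → x ≤ pair x y
left≤pair x y = ≤-trans (m≤m+n x y) (+≤pair x y)

right≤pair : ∀ x y → y ≤ pair x y
right≤pair x y = m≤n+m y _

-- One step along Cantor's antidiagonals; iterating it inverts `pair` without square roots.
next : ℕ × ℕ → ℕ × ℕ
next (zero  , y) = suc y , 0
next (suc x , y) = x , suc y

unpair : ℕ → ℕ × ℕ
unpair zero    = 0 , 0
unpair (suc n) = next (unpair n)

π₁ π₂ : ℕ → ℕ
π₁ = proj₁ ∘ unpair
π₂ = proj₂ ∘ unpair

pair-suc-zero : ∀ y → pair (suc y) 0 ≡ suc (pair 0 y)
pair-suc-zero y rewrite +-identityʳ y = trans (+-identityʳ _) (cong suc (+-comm y (triangle y)))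

pair-suc : ∀ x y → pair x (suc y) ≡ suc (pair (suc x) y)
pair-suc x y rewrite +-suc x y = +-suc _ y

pair-next : ∀ p → pair (proj₁ (next p)) (proj₂ (next p)) ≡ suc (pair (proj₁ p) (proj₂ p))
pair-next (zero  , y) = pair-suc-zero y
pair-next (suc x , y) = pair-suc x y

pair-π : ∀ n → pair (π₁ n) (π₂ n) ≡ n
pair-π zero    = refl
pair-π (suc n) = trans (pair-next (unpair n)) (cong suc (pair-π n))

-- The recursion is on the value `n`, kept as a separate variable: `pair-suc-zero` and `pair-suc`
-- identify the preceding point of the path.
unpair-unique : ∀ n x y → pair x y ≡ n → unpair n ≡ (x , y)
unpair-unique zero    zero    zero    eq = refl
unpair-unique (suc n) (suc x) zero    eq
  rewrite unpair-unique n 0 x (suc-injective (trans (sym (pair-suc-zero x)) eq)) = refl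
unpair-unique zero    x       (suc y) eq = contradiction (trans (sym (pair-suc x y)) eq) λ ()
unpair-unique (suc n) x       (suc y) eq
  rewrite unpair-unique n (suc x) y (suc-injective (trans (sym (pair-suc x y)) eq)) = refl

π₁-pair : ∀ x y → π₁ (pair x y) ≡ x
π₁-pair x y = cong proj₁ (unpair-unique _ x y refl)

π₂-pair : ∀ x y → π₂ (pair x y) ≡ y
π₂-pair x y = cong proj₂ (unpair-unique _ x y refl)

π₁≤ : ∀ n → π₁ n ≤ n
π₁≤ n = subst (π₁ n ≤_) (pair-π n) (left≤pair (π₁ n) (π₂ n))

π₂≤ : ∀ n → π₂ n ≤ n
π₂≤ n = subst (π₂ n ≤_) (pair-π n) (right≤pair (π₁ n) (π₂ n))

pair-mono : ∀ {x x′ y y′} → x ≤ x′ → y ≤ y′ → pair x y ≤ pair x′ y′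
pair-mono x≤ y≤ = +-mono-≤ (triangle-mono (+-mono-≤ x≤ y≤)) y≤
  where
  triangle-mono : ∀ {m n} → m ≤ n → triangle m ≤ triangle n
  triangle-mono z≤n       = z≤n
  triangle-mono (s≤s m≤n) = +-mono-≤ (s≤s m≤n) (triangle-mono m≤n)

-- Every number codes an infinite stream, with π₁ and π₂ as head and tail: since
-- pair 0 0 is 0, the number 0 codes the constant stream 0, and pair is cons.

drop : ℕ → ℕ → ℕ
drop zero    r = r
drop (suc i) r = π₂ (drop i r)

nth : ℕ → ℕ → ℕ
nth r i = π₁ (drop i r)

cons : ∀ {A : Set} → A → (ℕ → A) → ℕ → A
cons a σ zero    = a
cons a σ (suc i) = σ i

drop-pair : ∀ a r i → drop (suc i) (pair a r) ≡ drop i r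
drop-pair a r zero    = π₂-pair a r
drop-pair a r (suc i) = cong π₂ (drop-pair a r i)

nth-pair : ∀ a r i → nth (pair a r) i ≡ cons a (nth r) i
nth-pair a r zero    = π₁-pair a r
nth-pair a r (suc i) = cong π₁ (drop-pair a r i)

nth-drop : ∀ l r i → nth (drop l r) i ≡ nth r (l + i)
nth-drop l r i = cong π₁ (lemma i)
  where
  lemma : ∀ i → drop i (drop l r) ≡ drop (l + i) r
  lemma zero    = cong (λ j → drop j r) (sym (+-identityʳ l))
  lemma (suc i) = trans (cong π₂ (lemma i)) (cong (λ j → drop j r) (sym (+-suc l i)))

nth≤ : ∀ r i → nth r i ≤ r
nth≤ r i = ≤-trans (π₁≤ _) (drop≤ i)
  where
  drop≤ : ∀ i → drop i r ≤ r
  drop≤ zero    = ≤-refl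
  drop≤ (suc i) = ≤-trans (π₂≤ _) (drop≤ i)

-- Decoding Gödel numbers

code-% : ∀ t q → t < 6 → (t + 6 * q) % 6 ≡ t
code-% t q t<6 =
  trans (cong (λ z → (t + z) % 6) (*-comm 6 q)) (trans ([m+kn]%n≡m%n t q 6) (m<n⇒m%n≡m t<6))

code-/ : ∀ t q → t < 6 → (t + 6 * q) / 6 ≡ q
code-/ t q t<6 = *-cancelʳ-≡ _ _ 6 (+-cancelˡ-≡ t _ _ (begin
  t + (n / 6) * 6       ≡⟨ cong (_+ (n / 6) * 6) (sym (code-% t q t<6)) ⟩
  n % 6 + (n / 6) * 6   ≡⟨ sym (m≡m%n+[m/n]*n n 6) ⟩
  t + 6 * q             ≡⟨ cong (t +_) (*-comm 6 q) ⟩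
  t + q * 6             ∎))
  where
  open ≡-Reasoning
  n = t + 6 * q

build : ℕ → ℕ → Term → Term → Term → Term
build 0 q T U V = rel (π₁ q) (π₂ q)
build 1 q T U V = p′ T
build 2 q T U V = I′ T
build 3 q T U V = ¬′ T
build 4 q T U V = J′ U V
build _ q T U V = ∃′ T

-- Division by 6 is no structural descent, hence the fuel; codes of subterms are smaller, so `suc n`
-- is enough. All candidate subterms are decoded, and `build` keeps those that the tag calls for.
decodeWithin : ℕ → ℕ → Term
decodeWithin zero       n = rel 0 0
decodeWithin (suc fuel) n =
  build (n % 6) q (decodeWithin fuel q) (decodeWithin fuel (π₁ q)) (decodeWithin fuel (π₂ q))
  where q = n / 6

decode : ℕ → Term
decode n = decodeWithin (suc n) n

private
  fuel< : ∀ t {q f} → suc t + 6 * q < suc f → q < f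
  fuel< t (s≤s le) = ≤-trans (s≤s (≤-trans (m≤m+n _ _) (m≤n+m _ t))) le

decodeWithin-⌜⌝ : ∀ fuel T → ⌜ T ⌝ < fuel → decodeWithin fuel ⌜ T ⌝ ≡ T
decodeWithin-⌜⌝ (suc f) (rel k i) le
  rewrite code-% 0 (pair k i) z<s | code-/ 0 (pair k i) z<s | π₁-pair k i | π₂-pair k i = refl
decodeWithin-⌜⌝ (suc f) (p′ T) le
  rewrite code-% 1 ⌜ T ⌝ (s<s z<s) | code-/ 1 ⌜ T ⌝ (s<s z<s)
  = cong p′ (decodeWithin-⌜⌝ f T (fuel< 0 le))
decodeWithin-⌜⌝ (suc f) (I′ T) le
  rewrite code-% 2 ⌜ T ⌝ (s<s (s<s z<s)) | code-/ 2 ⌜ T ⌝ (s<s (s<s z<s))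
  = cong I′ (decodeWithin-⌜⌝ f T (fuel< 1 le))
decodeWithin-⌜⌝ (suc f) (¬′ T) le
  rewrite code-% 3 ⌜ T ⌝ (s<s (s<s (s<s z<s))) | code-/ 3 ⌜ T ⌝ (s<s (s<s (s<s z<s)))
  = cong ¬′ (decodeWithin-⌜⌝ f T (fuel< 2 le))
decodeWithin-⌜⌝ (suc f) (J′ T S) le
  rewrite code-% 4 (pair ⌜ T ⌝ ⌜ S ⌝) (s<s (s<s (s<s (s<s z<s))))
        | code-/ 4 (pair ⌜ T ⌝ ⌜ S ⌝) (s<s (s<s (s<s (s<s z<s))))
        | π₁-pair ⌜ T ⌝ ⌜ S ⌝ | π₂-pair ⌜ T ⌝ ⌜ S ⌝
  = cong₂ J′ (decodeWithin-⌜⌝ f T (≤-<-trans (left≤pair ⌜ T ⌝ ⌜ S ⌝) (fuel< 3 le)))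
             (decodeWithin-⌜⌝ f S (≤-<-trans (right≤pair ⌜ T ⌝ ⌜ S ⌝) (fuel< 3 le)))
decodeWithin-⌜⌝ (suc f) (∃′ T) le
  rewrite code-% 5 ⌜ T ⌝ (s<s (s<s (s<s (s<s (s<s z<s)))))
        | code-/ 5 ⌜ T ⌝ (s<s (s<s (s<s (s<s (s<s z<s)))))
  = cong ∃′ (decodeWithin-⌜⌝ f T (fuel< 4 le))

decode-⌜⌝ : ∀ T → decode ⌜ T ⌝ ≡ T
decode-⌜⌝ T = decodeWithin-⌜⌝ (suc ⌜ T ⌝) T (n<1+n _)

⌜⌝-injective : ∀ {T S} → ⌜ T ⌝ ≡ ⌜ S ⌝ → T ≡ S
⌜⌝-injective {T} {S} eq = trans (sym (decode-⌜⌝ T)) (trans (cong decode eq) (decode-⌜⌝ S))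

-- A nonzero tag rules out 0, the one number that division by 6 does not decrease.
/6< : ∀ n t → n ≡ suc t + 6 * (n / 6) → n / 6 < n
/6< zero    t ()
/6< (suc n) t _ = m/n<m (suc n) 6 (s≤s (s≤s z≤n))

⌜⌝-surjective : ∀ n → ∃[ T ] ⌜ T ⌝ ≡ n
⌜⌝-surjective = <-rec _ step
  where
  step : ∀ n → (∀ {m} → m < n → ∃[ T ] ⌜ T ⌝ ≡ m) → ∃[ T ] ⌜ T ⌝ ≡ n
  step n rec = go (n % 6) (m%n<n n 6) (trans (m≡m%n+[m/n]*n n 6) (cong (n % 6 +_) (*-comm (n / 6) 6)))
    where
    q = n / 6
    unary : (c : Term → Term) (t : ℕ) → (∀ T → ⌜ c T ⌝ ≡ suc t + 6 * ⌜ T ⌝) →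
            n ≡ suc t + 6 * q → ∃[ T ] ⌜ T ⌝ ≡ n
    unary c t code eq with rec (/6< n t eq)
    ... | T , eqT = c T , trans (code T) (trans (cong (λ z → suc t + 6 * z) eqT) (sym eq))
    go : ∀ t → t < 6 → n ≡ t + 6 * q → ∃[ T ] ⌜ T ⌝ ≡ n
    go 0 _ eq = rel (π₁ q) (π₂ q) , trans (cong (6 *_) (pair-π q)) (sym eq)
    go 1 _ eq = unary p′ 0 (λ _ → refl) eq
    go 2 _ eq = unary I′ 1 (λ _ → refl) eq
    go 3 _ eq = unary ¬′ 2 (λ _ → refl) eq
    go 4 _ eq with rec (≤-<-trans (π₁≤ q) (/6< n 3 eq)) | rec (≤-<-trans (π₂≤ q) (/6< n 3 eq))
    ... | T , eqT | S , eqS =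
      J′ T S , trans (cong₂ (λ u v → 4 + 6 * pair u v) eqT eqS)
                     (trans (cong (λ z → 4 + 6 * z) (pair-π q)) (sym eq))
    go 5 _ eq = unary ∃′ 4 (λ _ → refl) eq
    go (suc (suc (suc (suc (suc (suc _)))))) (s≤s (s≤s (s≤s (s≤s (s≤s (s≤s ())))))) _

arity : ℕ → ℕ
arity = ar ∘ decode

arity-⌜⌝ : ∀ T → arity ⌜ T ⌝ ≡ ar T
arity-⌜⌝ T = cong ar (decode-⌜⌝ T)

-- Computable functions and decidable predicates

computable-≗ : ∀ {n} {f g : Vec ℕ n → ℕ} → (∀ xs → f xs ≡ g xs) → Computable f → Computable g
computable-≗ f≗g (c , c⇓) = c , λ xs → subst (c [ xs ]⇓_) (f≗g xs) (c⇓ xs)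

var : ∀ {n} (i : Fin n) → Computable (λ xs → lookup xs i)
var i = proj i , λ xs → proj⇓ i

x₀ : ∀ {n} → Computable {1 + n} (λ xs → lookup xs zero)
x₀ = var zero

x₁ : ∀ {n} → Computable {2 + n} (λ xs → lookup xs (suc zero))
x₁ = var (suc zero)

x₂ : ∀ {n} → Computable {3 + n} (λ xs → lookup xs (suc (suc zero)))
x₂ = var (suc (suc zero))

Computable₁ : (ℕ → ℕ) → Set
Computable₁ f = ∃[ c ] (∀ x → c [ x ∷ [] ]⇓ f x)

Computable₂ : (ℕ → ℕ → ℕ) → Set
Computable₂ f = ∃[ c ] (∀ x y → c [ x ∷ y ∷ [] ]⇓ f x y)

app₁ : ∀ {n f} {g : Vec ℕ n → ℕ} → Computable₁ f → Computable g → Computable (λ xs → f (g xs))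
app₁ {g = g} (c , c⇓) (d , d⇓) =
  comp c (d ∷ []) , λ xs → comp⇓ (g xs ∷ []) (λ { zero → d⇓ xs }) (c⇓ (g xs))

app₂ : ∀ {n f} {g h : Vec ℕ n → ℕ} →
       Computable₂ f → Computable g → Computable h → Computable (λ xs → f (g xs) (h xs))
app₂ {g = g} {h} (c , c⇓) (d , d⇓) (e , e⇓) =
  comp c (d ∷ e ∷ []) , λ xs →
  comp⇓ (g xs ∷ h xs ∷ []) (λ { zero → d⇓ xs ; (suc zero) → e⇓ xs }) (c⇓ (g xs) (h xs))

curry₁ : ∀ {f} → Computable {1} (λ xs → f (lookup xs zero)) → Computable₁ f
curry₁ (c , c⇓) = c , λ x → c⇓ (x ∷ [])

curry₂ : ∀ {f} → Computable {2} (λ xs → f (lookup xs zero) (lookup xs (suc zero))) → Computable₂ f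
curry₂ (c , c⇓) = c , λ x y → c⇓ (x ∷ y ∷ [])

instantiate : ∀ {n} {f : Vec ℕ (suc n) → ℕ} {g : Vec ℕ n → ℕ} →
              Computable f → Computable g → Computable (λ xs → f (g xs ∷ xs))
instantiate {g = g} (c , c⇓) (d , d⇓) = comp c (d ∷ tabulate proj) , λ xs →
  comp⇓ (g xs ∷ xs) (λ { zero → d⇓ xs ; (suc i) → projections xs i }) (c⇓ (g xs ∷ xs))
  where
  projections : ∀ xs i → lookup (tabulate proj) i [ xs ]⇓ lookup xs i
  projections xs i rewrite lookup∘tabulate proj i = proj⇓ i

weaken : ∀ {n} {f : Vec ℕ n → ℕ} → Computable f → Computable {suc n} (λ xs → f (tail xs))
weaken (c , c⇓) = comp c (tabulate (proj ∘ suc)) , λ { (x ∷ xs) → comp⇓ xs (projections x xs) (c⇓ xs) }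
  where
  projections : ∀ x xs i → lookup (tabulate (proj ∘ suc)) i [ x ∷ xs ]⇓ lookup xs i
  projections x xs i rewrite lookup∘tabulate (proj ∘ suc) i = proj⇓ (suc i)

suc-computable : Computable₁ suc
suc-computable = succ , λ x → succ⇓

lit : ∀ {n} k → Computable {n} (λ _ → k)
lit zero    = comp zer [] , λ xs → comp⇓ [] (λ ()) zer⇓
lit (suc k) = app₁ suc-computable (lit k)

primitive-recursion : ∀ {n} {f : Vec ℕ (suc n) → ℕ} {g h} → Computable g → Computable h →
  (∀ xs → g xs ≡ f (0 ∷ xs)) → (∀ x xs → h (x ∷ f (x ∷ xs) ∷ xs) ≡ f (suc x ∷ xs)) → Computable f
primitive-recursion {f = f} (c , c⇓) (d , d⇓) eq₀ eq₁ = prec c d , λ { (x ∷ xs) → go x xs }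
  where
  go : ∀ x xs → prec c d [ x ∷ xs ]⇓ f (x ∷ xs)
  go zero    xs = subst (prec c d [ 0 ∷ xs ]⇓_) (eq₀ xs) (prec-zero⇓ (c⇓ xs))
  go (suc x) xs = subst (prec c d [ suc x ∷ xs ]⇓_) (eq₁ x xs) (prec-suc⇓ (go x xs) (d⇓ _))

+-computable : Computable₂ _+_
+-computable = curry₂ (primitive-recursion x₀ (app₁ suc-computable x₁) (λ _ → refl) (λ _ _ → refl))

*-computable : Computable₂ _*_
*-computable = curry₂ (primitive-recursion (lit 0) (app₂ +-computable x₂ x₁) (λ _ → refl) (λ _ _ → refl))

pred-computable : Computable₁ pred
pred-computable = curry₁ (primitive-recursion (lit 0) x₀ (λ _ → refl) (λ _ _ → refl))

∸-computable : Computable₂ _∸_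
-- Primitive recursion runs on the first argument, but subtraction recurs on its second.
∸-computable = curry₂ (app₂ (curry₂ {λ y x → x ∸ y} flipped) x₁ x₀)
  where
  flipped : Computable {2} (λ xs → lookup xs (suc zero) ∸ lookup xs zero)
  flipped = primitive-recursion x₀ (app₁ pred-computable x₁) (λ _ → refl)
                                (λ x xs → pred[m∸n]≡m∸[1+n] (lookup xs zero) x)

_⊕_ : ∀ {n} {f g : Vec ℕ n → ℕ} → Computable f → Computable g → Computable (λ xs → f xs + g xs)
_⊕_ = app₂ +-computable

_⊛_ : ∀ {n} {f g : Vec ℕ n → ℕ} → Computable f → Computable g → Computable (λ xs → f xs * g xs)
_⊛_ = app₂ *-computable

_⊖_ : ∀ {n} {f g : Vec ℕ n → ℕ} → Computable f → Computable g → Computable (λ xs → f xs ∸ g xs)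
_⊖_ = app₂ ∸-computable

infixl 6 _⊕_ _⊖_
infixl 7 _⊛_

ifZero : ℕ → ℕ → ℕ → ℕ
ifZero zero    a b = a
ifZero (suc _) a b = b

ifZero-computable : ∀ {n} {f g h : Vec ℕ n → ℕ} → Computable f → Computable g → Computable h →
                    Computable (λ xs → ifZero (f xs) (g xs) (h xs))
ifZero-computable {f = f} {g} {h} F G H =
  computable-≗ (λ xs → lemma (f xs)) ((lit 1 ⊖ F) ⊛ G ⊕ (lit 1 ⊖ (lit 1 ⊖ F)) ⊛ H)
  where
  lemma : ∀ {a b} k → (1 ∸ k) * a + (1 ∸ (1 ∸ k)) * b ≡ ifZero k a b
  lemma zero    = trans (+-identityʳ _) (*-identityˡ _)
  lemma {b = b} (suc k) rewrite 0∸n≡0 k = *-identityˡ b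

-- The characteristic functions used internally take the value 0 on the predicate, which
-- turns conjunctions into sums and bounded existential quantifiers into products.

Decidable : ∀ {n} → (Vec ℕ n → Set) → Set
Decidable P = ∃[ φ ] (Computable φ × (∀ xs → (φ xs ≡ 0 → P xs) × (P xs → φ xs ≡ 0)))

decidable-⇔ : ∀ {n} {P Q : Vec ℕ n → Set} → (∀ xs → (P xs → Q xs) × (Q xs → P xs)) →
              Decidable P → Decidable Q
decidable-⇔ P⇔Q (φ , Φ , φP) = φ , Φ , λ xs →
  proj₁ (P⇔Q xs) ∘ proj₁ (φP xs) , proj₂ (φP xs) ∘ proj₂ (P⇔Q xs)

dec : ∀ {n} {P : Vec ℕ n → Set} → Decidable P → ∀ xs → Dec (P xs)
dec (φ , _ , φP) xs with φ xs ≟ 0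
... | yes φ≡0 = yes (proj₁ (φP xs) φ≡0)
... | no  φ≢0 = no (φ≢0 ∘ proj₂ (φP xs))

decidable⇒computableRel : ∀ {n} {P : Vec ℕ n → Set} → Decidable P → ComputableRel P
decidable⇒computableRel {P = P} (φ , Φ , φP) = (λ xs → 1 ∸ φ xs) , lit 1 ⊖ Φ , λ xs → go xs (φ xs) refl
  where
  go : ∀ xs k → φ xs ≡ k → (1 ∸ φ xs ≡ 1 × P xs) ⊎ (1 ∸ φ xs ≡ 0 × ¬ P xs)
  go xs zero    eq = inj₁ (cong (1 ∸_) eq , proj₁ (φP xs) eq)
  go xs (suc k) eq = inj₂ (trans (cong (1 ∸_) eq) (0∸n≡0 k) ,
                           λ p → contradiction (trans (sym eq) (proj₂ (φP xs) p)) λ ())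

module _ {n} {P Q : Vec ℕ n → Set} where

  infixr 4 _×ᵈ_
  infixr 3 _→ᵈ_

  _×ᵈ_ : Decidable P → Decidable Q → Decidable (λ xs → P xs × Q xs)
  (φ , Φ , φP) ×ᵈ (ψ , Ψ , ψQ) = (λ xs → φ xs + ψ xs) , Φ ⊕ Ψ , λ xs →
    (λ eq → proj₁ (φP xs) (m+n≡0⇒m≡0 _ eq) , proj₁ (ψQ xs) (m+n≡0⇒n≡0 (φ xs) eq)) ,
    (λ (p , q) → cong₂ _+_ (proj₂ (φP xs) p) (proj₂ (ψQ xs) q))

  _→ᵈ_ : Decidable P → Decidable Q → Decidable (λ xs → P xs → Q xs)
  (φ , Φ , φP) →ᵈ (ψ , Ψ , ψQ) =
    (λ xs → ifZero (φ xs) (ψ xs) 0) , ifZero-computable Φ Ψ (lit 0) , λ xs →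
    (λ eq p → proj₁ (ψQ xs) (subst (λ k → ifZero k (ψ xs) 0 ≡ 0) (proj₂ (φP xs) p) eq)) ,
    (λ p→q → go (φ xs) λ eq → proj₂ (ψQ xs) (p→q (proj₁ (φP xs) eq)))
    where
    go : ∀ {m} k → (k ≡ 0 → m ≡ 0) → ifZero k m 0 ≡ 0
    go zero    h = h refl
    go (suc k) h = refl

module _ {n} {f g : Vec ℕ n → ℕ} where

  infix 5 _≡ᵈ_ _<ᵈ_

  _≡ᵈ_ : Computable f → Computable g → Decidable (λ xs → f xs ≡ g xs)
  F ≡ᵈ G = (λ xs → (f xs ∸ g xs) + (g xs ∸ f xs)) , (F ⊖ G) ⊕ (G ⊖ F) , λ xs →
    (λ eq → ≤-antisym (m∸n≡0⇒m≤n (m+n≡0⇒m≡0 _ eq))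
                      (m∸n≡0⇒m≤n (m+n≡0⇒n≡0 (f xs ∸ g xs) eq))) ,
    (λ eq → cong₂ _+_ (m≤n⇒m∸n≡0 (≤-reflexive eq)) (m≤n⇒m∸n≡0 (≤-reflexive (sym eq))))

  _<ᵈ_ : Computable f → Computable g → Decidable (λ xs → f xs < g xs)
  F <ᵈ G = (λ xs → suc (f xs) ∸ g xs) , app₁ suc-computable F ⊖ G , λ xs →
    m∸n≡0⇒m≤n , m≤n⇒m∸n≡0

sumBelow productBelow : (ℕ → ℕ) → ℕ → ℕ
sumBelow     u zero    = 0
sumBelow     u (suc k) = u k + sumBelow u k
productBelow u zero    = 1
productBelow u (suc k) = u k * productBelow u k

sumBelow≡0⇒ : ∀ u k → sumBelow u k ≡ 0 → ∀ z → z < k → u z ≡ 0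
sumBelow≡0⇒ u (suc k) eq z (s≤s z≤k) with m≤n⇒m<n∨m≡n z≤k
... | inj₁ z<k  = sumBelow≡0⇒ u k (m+n≡0⇒n≡0 (u k) eq) z z<k
... | inj₂ refl = m+n≡0⇒m≡0 (u k) eq

⇒sumBelow≡0 : ∀ u k → (∀ z → z < k → u z ≡ 0) → sumBelow u k ≡ 0
⇒sumBelow≡0 u zero    h = refl
⇒sumBelow≡0 u (suc k) h = cong₂ _+_ (h k ≤-refl) (⇒sumBelow≡0 u k λ z z<k → h z (m≤n⇒m≤1+n z<k))

productBelow≡0⇒ : ∀ u k → productBelow u k ≡ 0 → ∃[ z ] (z < k × u z ≡ 0)
productBelow≡0⇒ u (suc k) eq with m*n≡0⇒m≡0∨n≡0 (u k) eq
... | inj₁ uk≡0 = k , ≤-refl , uk≡0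
... | inj₂ rest with productBelow≡0⇒ u k rest
...   | z , z<k , uz≡0 = z , m≤n⇒m≤1+n z<k , uz≡0

⇒productBelow≡0 : ∀ u k z → z < k → u z ≡ 0 → productBelow u k ≡ 0
⇒productBelow≡0 u (suc k) z (s≤s z≤k) eq with m≤n⇒m<n∨m≡n z≤k
... | inj₁ z<k  = trans (cong (u k *_) (⇒productBelow≡0 u k z z<k eq)) (*-zeroʳ (u k))
... | inj₂ refl = cong (_* productBelow u k) eq

module _ {n} {b : Vec ℕ n → ℕ} {P : Vec ℕ (suc n) → Set} where

  private
    skip : ∀ {φ : Vec ℕ (suc n) → ℕ} → Computable φ →
           Computable {suc (suc n)} (λ { (x ∷ r ∷ xs) → φ (x ∷ xs) })
    skip {φ} (c , c⇓) = comp c (proj zero ∷ tabulate (λ i → proj (suc (suc i)))) , λ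
      { (x ∷ r ∷ xs) → comp⇓ (x ∷ xs) (λ { zero → proj⇓ zero ; (suc i) → projections x r xs i }) (c⇓ _) }
      where
      projections : ∀ x r (xs : Vec ℕ n) i →
                    lookup (tabulate (λ i → proj (suc (suc i)))) i [ x ∷ r ∷ xs ]⇓ lookup xs i
      projections x r xs i rewrite lookup∘tabulate (λ i → proj {2 + n} (suc (suc i))) i = proj⇓ (suc (suc i))

  ∀<ᵈ : Computable b → Decidable P → Decidable (λ xs → ∀ z → z < b xs → P (z ∷ xs))
  ∀<ᵈ B (φ , Φ , φP) = (λ xs → sum (b xs ∷ xs)) , instantiate Sum B , λ xs →
    (λ eq z z<b → proj₁ (φP _) (sumBelow≡0⇒ _ (b xs) eq z z<b)) ,
    (λ h → ⇒sumBelow≡0 _ (b xs) λ z z<b → proj₂ (φP _) (h z z<b))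
    where
    sum : Vec ℕ (suc n) → ℕ
    sum (k ∷ xs) = sumBelow (λ z → φ (z ∷ xs)) k
    Sum : Computable sum
    Sum = primitive-recursion (lit 0) (skip Φ ⊕ x₁) (λ _ → refl) (λ _ _ → refl)

  ∃<ᵈ : Computable b → Decidable P → Decidable (λ xs → ∃[ z ] (z < b xs × P (z ∷ xs)))
  ∃<ᵈ B (φ , Φ , φP) = (λ xs → product (b xs ∷ xs)) , instantiate Product B , λ xs →
    (λ eq → let z , z<b , φ≡0 = productBelow≡0⇒ _ (b xs) eq in z , z<b , proj₁ (φP _) φ≡0) ,
    (λ (z , z<b , p) → ⇒productBelow≡0 _ (b xs) z z<b (proj₂ (φP _) p))
    where
    product : Vec ℕ (suc n) → ℕ
    product (k ∷ xs) = productBelow (λ z → φ (z ∷ xs)) k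
    Product : Computable product
    Product = primitive-recursion (lit 1) (skip Φ ⊛ x₁) (λ _ → refl) (λ _ _ → refl)

-- Search for the first zero of the characteristic function of the graph: totality puts a zero at
-- `f xs`, uniqueness excludes any before it. Inverse functions thus need no recursion equations.
decidable-graph⇒computable : ∀ {n} {G : Vec ℕ (suc n) → Set} (f : Vec ℕ n → ℕ) → Decidable G →
  (∀ xs → G (f xs ∷ xs)) → (∀ z xs → G (z ∷ xs) → z ≡ f xs) → Computable f
decidable-graph⇒computable f (φ , (c , c⇓) , φG) total unique = mu c , λ xs →
  mu⇓ (λ i → pred (φ (toℕ i ∷ xs)))
      (λ i → subst (c [ toℕ i ∷ xs ]⇓_) (sym (suc-pred′ (nonzero xs i))) (c⇓ _))
      (subst (c [ f xs ∷ xs ]⇓_) (proj₂ (φG _) (total xs)) (c⇓ _))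
  where
  nonzero : ∀ xs (i : Fin (f xs)) → φ (toℕ i ∷ xs) ≢ 0
  nonzero xs i eq = <-irrefl (unique _ xs (proj₁ (φG _) eq)) (toℕ<n i)
  suc-pred′ : ∀ {k} → k ≢ 0 → suc (pred k) ≡ k
  suc-pred′ {zero}  k≢0 = contradiction refl k≢0
  suc-pred′ {suc k} k≢0 = refl

-- Computability of the codings

triangle-computable : Computable₁ triangle
triangle-computable =
  curry₁ (primitive-recursion (lit 0) (app₁ suc-computable x₀ ⊕ x₁) (λ _ → refl) (λ _ _ → refl))

pair-computable : Computable₂ pair
pair-computable = curry₂ (app₁ triangle-computable (x₀ ⊕ x₁) ⊕ x₁)

π₁-computable : Computable₁ π₁
π₁-computable = curry₁ (decidable-graph⇒computable (λ xs → π₁ (lookup xs zero))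
  -- Inside the quantifier `x₀` is the other component, `x₁` the candidate value and `x₂` the input;
  -- in the bound, with one variable fewer, the input is `x₁`.
  (∃<ᵈ (app₁ suc-computable x₁) (app₂ pair-computable x₁ x₀ ≡ᵈ x₂))
  (λ xs → let n = lookup xs zero in π₂ n , s≤s (π₂≤ n) , pair-π n)
  (λ { z xs (y , _ , eq) → trans (sym (π₁-pair z y)) (cong π₁ eq) }))

π₂-computable : Computable₁ π₂
π₂-computable = curry₁ (decidable-graph⇒computable (λ xs → π₂ (lookup xs zero))
  (∃<ᵈ (app₁ suc-computable x₁) (app₂ pair-computable x₀ x₁ ≡ᵈ x₂))
  (λ xs → let n = lookup xs zero in π₁ n , s≤s (π₁≤ n) , pair-π n)
  (λ { z xs (y , _ , eq) → trans (sym (π₂-pair y z)) (cong π₂ eq) }))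

private
  n≡n%6+6*[n/6] : ∀ n → n % 6 + 6 * (n / 6) ≡ n
  n≡n%6+6*[n/6] n = trans (cong (n % 6 +_) (*-comm 6 (n / 6))) (sym (m≡m%n+[m/n]*n n 6))

/6-computable : Computable₁ (_/ 6)
/6-computable = curry₁ (decidable-graph⇒computable (λ xs → lookup xs zero / 6)
  (∃<ᵈ (lit 6) (x₀ ⊕ lit 6 ⊛ x₁ ≡ᵈ x₂))
  (λ xs → let n = lookup xs zero in n % 6 , m%n<n n 6 , n≡n%6+6*[n/6] n)
  (λ { z xs (t , t<6 , eq) → trans (sym (code-/ t z t<6)) (cong (_/ 6) eq) }))

%6-computable : Computable₁ (_% 6)
%6-computable = curry₁ (computable-≗ (λ xs → sym (m%n≡m∸m/n*n (lookup xs zero) 6))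
  (x₀ ⊖ app₁ /6-computable x₀ ⊛ lit 6))

drop-computable : Computable₂ drop
drop-computable = curry₂ (primitive-recursion x₀ (app₁ π₂-computable x₁) (λ _ → refl) (λ _ _ → refl))

nth-computable : Computable₂ nth
nth-computable = curry₂ (app₁ π₁-computable (app₂ drop-computable x₁ x₀))

-- The arity of a term is computed from its code by course-of-values recursion.

arI-computable : Computable₁ arI
arI-computable = curry₁ (primitive-recursion (lit 0) (ifZero-computable x₀ (lit 1) x₀) (λ _ → refl)
  (λ { zero _ → refl ; (suc x) _ → refl }))

arityStep : (t q a b c : ℕ) → ℕ
arityStep t q a b c =
  ifZero t (π₁ q) (ifZero (t ∸ 1) a (ifZero (t ∸ 2) (arI a) (ifZero (t ∸ 3) a (ifZero (t ∸ 4) (b + c) (pred a)))))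

-- One step of the recursion, for any table `a` that is right below `n`. Entries at numbers that are
-- not codes of immediate subterms are discarded by `arityStep`, so nothing is asked of them.
arity-unfold : ∀ n (a : ℕ → ℕ) → (∀ j → j < n → a j ≡ arity j) →
               arityStep (n % 6) (n / 6) (a (n / 6)) (a (π₁ (n / 6))) (a (π₂ (n / 6))) ≡ arity n
arity-unfold n a a≗ with ⌜⌝-surjective n
... | T , refl = trans (go T a≗) (sym (arity-⌜⌝ T))
  where
  Goal : Term → ℕ → ℕ → Set
  Goal T t q = arityStep t q (a q) (a (π₁ q)) (a (π₂ q)) ≡ ar T
  reduce : ∀ T t q → t < 6 → ⌜ T ⌝ ≡ t + 6 * q → Goal T t q → Goal T (⌜ T ⌝ % 6) (⌜ T ⌝ / 6)
  reduce T t q t<6 eq = subst₂ (Goal T) (sym (trans (cong (_% 6) eq) (code-% t q t<6)))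
                                        (sym (trans (cong (_/ 6) eq) (code-/ t q t<6)))
  below : ∀ t q → q < suc t + 6 * q
  below t q = s≤s (≤-trans (m≤m+n q _) (m≤n+m _ t))
  go : ∀ T → (∀ j → j < ⌜ T ⌝ → a j ≡ arity j) → Goal T (⌜ T ⌝ % 6) (⌜ T ⌝ / 6)
  go (rel k i) h = reduce (rel k i) 0 (pair k i) z<s refl (π₁-pair k i)
  go (p′ T) h = reduce (p′ T) 1 ⌜ T ⌝ (s<s z<s) refl (trans (h _ (below 0 _)) (arity-⌜⌝ T))
  go (I′ T) h = reduce (I′ T) 2 ⌜ T ⌝ (s<s (s<s z<s)) refl
    (cong arI (trans (h _ (below 1 _)) (arity-⌜⌝ T)))
  go (¬′ T) h = reduce (¬′ T) 3 ⌜ T ⌝ (s<s (s<s (s<s z<s))) refl (trans (h _ (below 2 _)) (arity-⌜⌝ T))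
  go (J′ T S) h = reduce (J′ T S) 4 (pair ⌜ T ⌝ ⌜ S ⌝) (s<s (s<s (s<s (s<s z<s)))) refl
    (cong₂ _+_ (component T (left≤pair ⌜ T ⌝ ⌜ S ⌝) (π₁-pair ⌜ T ⌝ ⌜ S ⌝))
               (component S (right≤pair ⌜ T ⌝ ⌜ S ⌝) (π₂-pair ⌜ T ⌝ ⌜ S ⌝)))
    where
    component : ∀ U {j} → ⌜ U ⌝ ≤ pair ⌜ T ⌝ ⌜ S ⌝ → j ≡ ⌜ U ⌝ → a j ≡ ar U
    component U le refl = trans (h _ (≤-<-trans le (below 3 _))) (arity-⌜⌝ U)
  go (∃′ T) h = reduce (∃′ T) 5 ⌜ T ⌝ (s<s (s<s (s<s (s<s (s<s z<s))))) refl
    (cong pred (trans (h _ (below 4 _)) (arity-⌜⌝ T)))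

-- The table grows at its head, so the entry for `j` sits at position `n ∸ suc j`.
arities : ℕ → ℕ
arities zero    = 0
arities (suc n) = pair (arity n) (arities n)

nth-arities : ∀ n j → j < n → nth (arities n) (n ∸ suc j) ≡ arity j
nth-arities (suc n) j (s≤s j≤n) with m≤n⇒m<n∨m≡n j≤n
... | inj₂ refl rewrite n∸n≡0 j = π₁-pair (arity j) (arities j)
... | inj₁ j<n = trans (cong (nth (arities (suc n))) (+-∸-assoc 1 j<n))
                       (trans (nth-pair (arity n) (arities n) (suc (n ∸ suc j))) (nth-arities n j j<n))

arities-computable : Computable₁ arities
arities-computable = curry₁ (primitive-recursion (lit 0)
  (app₂ pair-computable (ifZero-computable tag (app₁ π₁-computable q)
    (ifZero-computable (tag ⊖ lit 1) (at q) (ifZero-computable (tag ⊖ lit 2) (app₁ arI-computable (at q))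
    (ifZero-computable (tag ⊖ lit 3) (at q) (ifZero-computable (tag ⊖ lit 4)
      (at (app₁ π₁-computable q) ⊕ at (app₁ π₂-computable q)) (app₁ pred-computable (at q))))))) x₁)
  (λ _ → refl)
  (λ n _ → cong (λ k → pair k (arities n))
             (arity-unfold n (λ j → nth (arities n) (n ∸ suc j)) (nth-arities n))))
  where
  tag : Computable {2} (λ xs → lookup xs zero % 6)
  tag = app₁ %6-computable x₀
  q : Computable {2} (λ xs → lookup xs zero / 6)
  q = app₁ /6-computable x₀
  at : ∀ {f : Vec ℕ 2 → ℕ} → Computable f →
       Computable (λ xs → nth (lookup xs (suc zero)) (lookup xs zero ∸ suc (f xs)))
  at F = app₂ nth-computable x₁ (x₀ ⊖ app₁ suc-computable F)

arity-computable : Computable₁ arity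
arity-computable = curry₁ (computable-≗ (λ xs → π₁-pair (arity (lookup xs zero)) (arities (lookup xs zero)))
  (app₁ π₁-computable (app₁ arities-computable (app₁ suc-computable x₀))))

-- Reading the arguments of a relation off a stream

-- The LAST component of the tuple is the head of the stream, so that ∃, I and J consume
-- the stream from its head. A relation ignores the stream beyond its arity; this makes
-- the clauses below uniform in the arity, including the degenerate cases of p, I and ∃.

module _ {D : Set} where

  vecOf : ∀ k → (ℕ → D) → Vec D k
  vecOf zero    σ = []
  vecOf (suc k) σ = vecOf k (σ ∘ suc) ∷ʳ σ 0

  vecOf-∷ : ∀ k σ → vecOf (suc k) σ ≡ σ k ∷ vecOf k σ
  vecOf-∷ zero    σ = refl
  vecOf-∷ (suc k) σ = cong (_∷ʳ σ 0) (vecOf-∷ k (σ ∘ suc))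

  vecOf-cong : ∀ k {σ τ : ℕ → D} → (∀ i → i < k → σ i ≡ τ i) → vecOf k σ ≡ vecOf k τ
  vecOf-cong zero    σ≗τ = refl
  vecOf-cong (suc k) σ≗τ = cong₂ _∷ʳ_ (vecOf-cong k λ i i<k → σ≗τ (suc i) (s<s i<k)) (σ≗τ 0 z<s)

  vecOf-++ : ∀ k l σ → vecOf (k + l) σ ≡ vecOf k (λ i → σ (l + i)) ++ vecOf l σ
  vecOf-++ zero    l σ = refl
  vecOf-++ (suc k) l σ = begin
    vecOf (suc (k + l)) σ                                     ≡⟨ vecOf-∷ (k + l) σ ⟩
    σ (k + l) ∷ vecOf (k + l) σ                               ≡⟨ cong₂ _∷_ (cong σ (+-comm k l)) (vecOf-++ k l σ) ⟩
    (σ (l + k) ∷ vecOf k (λ i → σ (l + i))) ++ vecOf l σ      ≡⟨ cong (_++ vecOf l σ) (sym (vecOf-∷ k _)) ⟩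
    vecOf (suc k) (λ i → σ (l + i)) ++ vecOf l σ              ∎
    where open ≡-Reasoning

  vecOf-surjective : D → ∀ {k} (v : Vec D k) → ∃[ σ ] vecOf k σ ≡ v
  vecOf-surjective d {zero}  [] = const d , refl
  vecOf-surjective d {suc k} v with initLast v
  ... | as , a , refl with vecOf-surjective d as
  ...   | σ , eq = cons a σ , cong (_∷ʳ a) eq

  -- Rotation is a single cons: the first component, `σ (k ∸ 1)`, becomes the last, and its old copy
  -- moves to position `k`, beyond what `R` reads.
  pᴿ-vecOf : ∀ {k} (R : AD D k) σ → pᴿ R (vecOf k σ) ≡ R (vecOf k (cons (σ (k ∸ 1)) σ))
  pᴿ-vecOf {0}           R σ = refl
  pᴿ-vecOf {1}           R σ = refl
  pᴿ-vecOf {suc (suc k)} R σ = cong (pᴿ R) (vecOf-∷ (suc k) σ)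

  Iᴿ-vecOf : ∀ {k} (R : AD D k) σ → Iᴿ R (vecOf (arI k) σ) ⇔ R (vecOf k (cons (σ 0) σ))
  Iᴿ-vecOf {0}           R σ = mk⇔ id id
  Iᴿ-vecOf {1}           R σ = mk⇔ id id
  Iᴿ-vecOf {suc (suc k)} R σ = mk⇔ (λ { (a , r , refl) → subst (λ a → R (v ∷ʳ a)) last-v r })
                                   (λ r → σ 0 , r , last-v)
    where
    v = vecOf (suc k) σ
    last-v : last v ≡ σ 0
    last-v = last-∷ʳ (σ 0) (vecOf k (σ ∘ suc))

  Jᴿ-vecOf : ∀ {k l} (R : AD D k) (S : AD D l) σ →
             Jᴿ R S (vecOf (k + l) σ) ⇔ (R (vecOf k (λ i → σ (l + i))) × S (vecOf l σ))
  Jᴿ-vecOf {k} {l} R S σ = mk⇔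
    (λ { (as , bs , eq , r , s) →
         let eqs = ++-injective _ as (trans (sym (vecOf-++ k l σ)) eq)
         in subst R (sym (proj₁ eqs)) r , subst S (sym (proj₂ eqs)) s })
    (λ (r , s) → _ , _ , vecOf-++ k l σ , r , s)

  ∃ᴿ-vecOf : D → ∀ {k} (R : AD D k) σ → ∃ᴿ R (vecOf (pred k) σ) ⇔ (∃[ a ] R (vecOf k (cons a σ)))
  -- In arity 0 the quantifier is vacuous; the nonempty domain supplies the witness.
  ∃ᴿ-vecOf d {zero}  R σ = mk⇔ (d ,_) proj₂
  ∃ᴿ-vecOf d {suc k} R σ = mk⇔ id id

module Semantics (𝔄 : Model) where
  open Model 𝔄

  Sem : Term → (ℕ → Dom) → Set
  Sem T σ = ⟦_⟧ 𝔄 T (vecOf (ar T) σ)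

  Sem-≗< : ∀ T {σ τ} → (∀ i → i < ar T → σ i ≡ τ i) → Sem T σ → Sem T τ
  Sem-≗< T σ≗τ = subst (⟦_⟧ 𝔄 T) (vecOf-cong (ar T) σ≗τ)

  Sem-≗ : ∀ T {σ τ} → (∀ i → σ i ≡ τ i) → Sem T σ ⇔ Sem T τ
  Sem-≗ T σ≗τ = mk⇔ (Sem-≗< T λ i _ → σ≗τ i) (Sem-≗< T λ i _ → sym (σ≗τ i))

  Sem-p : ∀ T σ → Sem (p′ T) σ ⇔ Sem T (cons (σ (ar T ∸ 1)) σ)
  Sem-p T σ = mk⇔ (subst id (pᴿ-vecOf (⟦_⟧ 𝔄 T) σ)) (subst id (sym (pᴿ-vecOf (⟦_⟧ 𝔄 T) σ)))

  Sem-I : ∀ T σ → Sem (I′ T) σ ⇔ Sem T (cons (σ 0) σ)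
  Sem-I T σ = Iᴿ-vecOf (⟦_⟧ 𝔄 T) σ

  Sem-J : ∀ T S σ → Sem (J′ T S) σ ⇔ (Sem T (λ i → σ (ar S + i)) × Sem S σ)
  Sem-J T S σ = Jᴿ-vecOf (⟦_⟧ 𝔄 T) (⟦_⟧ 𝔄 S) σ

  Sem-∃ : ∀ T σ → Sem (∃′ T) σ ⇔ (∃[ a ] Sem T (cons a σ))
  Sem-∃ T σ = ∃ᴿ-vecOf element (⟦_⟧ 𝔄 T) σ

  ≢∅⇔¬¬Sem : ∀ T → (¬ (⟦_⟧ 𝔄 T ≐ ∅)) ⇔ (¬ ¬ ∃ (Sem T))
  ≢∅⇔¬¬Sem T = mk⇔
    (λ ≢∅ none → ≢∅ ((λ {v} t → none (witness v t)) , λ ()))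
    (λ some ≡∅ → some λ (σ , s) → proj₁ ≡∅ s)
    where
    witness : ∀ v → ⟦_⟧ 𝔄 T v → ∃ (Sem T)
    witness v t with vecOf-surjective element v
    ... | σ , refl = σ , t

-- Compactness

Iff : Set → Set → Set
Iff A B = (A → B) × (B → A)

¬¬-LEM : ∀ {A : Set} {W : Set} → (A → ¬ ¬ W) → (¬ A → ¬ ¬ W) → ¬ ¬ W
¬¬-LEM yes-case no-case k = no-case (λ a → yes-case a k) k

DecidesBelow : ℕ → (ℕ → Set) → (ℕ → Bool) → Set
DecidesBelow N Q b = ∀ x → x < N → Iff (Q x) (b x ≡ true)

-- Double negations of finitely many instances of excluded middle can be combined into one.
finite-LEM : ∀ N (Q : ℕ → Set) → ¬ ¬ ∃ (DecidesBelow N Q)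
finite-LEM zero    Q k = k (const false , λ _ ())
finite-LEM (suc N) Q = ¬¬-LEM {Q 0}
  (λ q  → ¬¬-map (extend true (const refl , const q)) rest)
  (λ ¬q → ¬¬-map (extend false ((λ q → contradiction q ¬q) , λ ())) rest)
  where
  rest = finite-LEM N (Q ∘ suc)
  extend : ∀ c → Iff (Q 0) (c ≡ true) → ∃ (DecidesBelow N (Q ∘ suc)) → ∃ (DecidesBelow (suc N) Q)
  extend c iff (b , b-iff) = cons c b , λ { zero _ → iff ; (suc x) (s≤s x<N) → b-iff x x<N }

-- A constructive substitute for weak König's lemma: the path that turns to true whenever
-- this keeps all the constraints satisfiable need not be a Boolean function, but it is
-- definable as a predicate, and up to double negation it has every finite initial segment.

module Compactness (P : ℕ → (ℕ → Bool) → Set)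
                   (antitone : ∀ {M N b} → M ≤ N → P N b → P M b)
                   (satisfiable : ∀ N → ∃ (P N)) where

  -- A node lists its latest bit first, so the head of `c ∷ s` is the value at `length s`.
  Extends : (ℕ → Bool) → List Bool → Set
  Extends b []      = ⊤
  Extends b (c ∷ s) = b (length s) ≡ c × Extends b s

  Extendible : List Bool → Set
  Extendible s = ∀ N → ¬ ¬ (∃[ b ] (P N b × Extends b s))

  OnPath : List Bool → Set
  OnPath []          = ⊤
  OnPath (true  ∷ s) = OnPath s × Extendible (true ∷ s)
  OnPath (false ∷ s) = OnPath s × ¬ Extendible (true ∷ s)

  Path : ℕ → Set
  Path i = ∃[ s ] (length s ≡ i × OnPath (true ∷ s))

  onPath-tail : ∀ c s → OnPath (c ∷ s) → OnPath s
  onPath-tail true  s = proj₁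
  onPath-tail false s = proj₁

  onPath-unique : ∀ s s′ → OnPath s → OnPath s′ → length s ≡ length s′ → s ≡ s′
  onPath-unique []      []       _ _  _  = refl
  onPath-unique (c ∷ s) (d ∷ s′) p o′ eq
    with onPath-unique s s′ (onPath-tail c s p) (onPath-tail d s′ o′) (suc-injective eq)
  ... | refl = same c d p o′
    where
    same : ∀ c d → OnPath (c ∷ s) → OnPath (d ∷ s) → c ∷ s ≡ d ∷ s
    same true  true  _ _ = refl
    same true  false (_ , ext) (_ , ¬ext) = contradiction ext ¬ext
    same false true  (_ , ¬ext) (_ , ext) = contradiction ext ¬ext
    same false false _ _ = refl

  -- If false fails at level `N`, every assignment that extends `s` and meets level `M ⊔ N` takes
  -- the value true next; hence `true ∷ s` is extendible at every `M`.
  extendible-false : ∀ s → Extendible s → ¬ Extendible (true ∷ s) → Extendible (false ∷ s)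
  extendible-false s ext ¬ext N none = ¬ext λ M none′ → ext (M ⊔ N) λ (b , p , e) →
    split b p e (b (length s)) refl none none′
    where
    split : ∀ {M} b → P (M ⊔ N) b → Extends b s → ∀ c → b (length s) ≡ c →
            ¬ (∃[ b ] (P N b × Extends b (false ∷ s))) → ¬ ¬ (∃[ b ] (P M b × Extends b (true ∷ s)))
    split {M} b p e true  eq none none′ = none′ (b , antitone (m≤m⊔n M N) p , eq , e)
    split {M} b p e false eq none none′ = none (b , antitone (m≤n⊔m M N) p , eq , e)

  initial-segment : ∀ N → ¬ ¬ (∃[ s ] (length s ≡ N × OnPath s × Extendible s))
  initial-segment zero    k = k ([] , refl , tt , λ N none → none (proj₁ (satisfiable N) , proj₂ (satisfiable N) , tt))
  initial-segment (suc N) k = initial-segment N λ (s , eq , p , ext) →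
    ¬¬-LEM {Extendible (true ∷ s)}
      (λ ext′  → λ k → k (true ∷ s , cong suc eq , (p , ext′) , ext′))
      (λ ¬ext′ → λ k → k (false ∷ s , cong suc eq , (p , ¬ext′) , extendible-false s ext ¬ext′))
      k

  path-of : ∀ b s → OnPath s → Extends b s → ∀ i → i < length s → Iff (Path i) (b i ≡ true)
  path-of b (c ∷ s) p (eq , e) i (s≤s i≤) with m≤n⇒m<n∨m≡n i≤
  ... | inj₁ i<   = path-of b s (onPath-tail c s p) e i i<
  ... | inj₂ refl = top c p eq
    where
    top : ∀ c → OnPath (c ∷ s) → b i ≡ c → Iff (Path i) (b i ≡ true)
    top true  p eq = const eq , const (s , refl , p)
    top false p eq =
      (λ (s′ , eq′ , o′) → contradiction
        (subst Extendible (cong (true ∷_) (onPath-unique s′ s (proj₁ o′) (proj₁ p) eq′)) (proj₂ o′)) (proj₂ p)) ,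
      (λ eq′ → contradiction (trans (sym eq) eq′) λ ())

  -- The initial segment of length `N` extends to an assignment meeting level `N`, which coincides
  -- with the path below `N`. Constraints that look only below `N` therefore pass to the path
  -- itself.
  compactness : ∀ N → ¬ ¬ (∃[ b ] (P N b × DecidesBelow N Path b))
  compactness N k = initial-segment N λ { (s , refl , p , ext) →
    ext N λ (b , q , e) → k (b , q , path-of b s p e) }

-- Membership in Π₁⁰

-- The propositional variable x = pair n r says that the term with code n holds of the
-- arguments listed by r, in a model with domain ℕ. The number x itself also serves as
-- the Henkin witness for this statement if n codes a term of the form ∃′ T.

Clause : (N : ℕ) (B : ℕ → Set) (n r z tag q : ℕ) → Set
Clause N B n r z 0 q =
  π₁ z ≡ n → (∀ j → j < π₁ q → nth r j ≡ nth (π₂ z) j) → B (pair n r) → B z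
Clause N B n r z 1 q = let y = pair q (pair (nth r (arity q ∸ 1)) r) in
  y < N → Iff (B (pair n r)) (B y)
Clause N B n r z 2 q = let y = pair q (pair (nth r 0) r) in
  y < N → Iff (B (pair n r)) (B y)
Clause N B n r z 3 q = let y = pair q r in
  y < N → Iff (B (pair n r)) (¬ B y)
Clause N B n r z 4 q = let u = pair (π₁ q) (drop (arity (π₂ q)) r) ; v = pair (π₂ q) r in
  u < N → v < N → Iff (B (pair n r)) (B u × B v)
Clause N B n r z 5 q = let y = pair q (pair (pair n r) r) in
  (y < N → B (pair n r) → B y) ×
  (π₁ z ≡ q → π₂ (π₂ z) ≡ r → B z → B (pair n r))
Clause N B n r z _ q = ⊤

closure : ℕ → ℕ → ℕ
closure zero    n = n
closure (suc k) n = 5 + 6 * closure k n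

-- `closure` acts on codes as iterated `∃′`, so this variable says that the existential closure of
-- the input term holds. The closure is nullary and reads nothing of the stream 0.
root : ℕ → ℕ
root n = pair (closure (arity n) n) 0

-- One bound limits both the clauses and the variables they mention, which gives `good-mono` and
-- `good-cong`. The number `z` ranges over the second argument list of a relation symbol (tag 0) and
-- over the instances that imply an existential statement (tag 5).
Good : (n N : ℕ) (B : ℕ → Set) → Set
Good n N B =
  (∀ x → x < N → ∀ z → z < N → Clause N B (π₁ x) (π₂ x) z (π₁ x % 6) (π₁ x / 6)) ×
  (root n < N → B (root n))

clause-mono : ∀ {M N B} → M ≤ N → ∀ n r z tag q → Clause N B n r z tag q → Clause M B n r z tag q
clause-mono M≤N n r z 0 q c = c
clause-mono M≤N n r z 1 q c = λ y< → c (<-≤-trans y< M≤N)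
clause-mono M≤N n r z 2 q c = λ y< → c (<-≤-trans y< M≤N)
clause-mono M≤N n r z 3 q c = λ y< → c (<-≤-trans y< M≤N)
clause-mono M≤N n r z 4 q c = λ u< v< → c (<-≤-trans u< M≤N) (<-≤-trans v< M≤N)
clause-mono M≤N n r z 5 q c = (λ y< → proj₁ c (<-≤-trans y< M≤N)) , proj₂ c
clause-mono M≤N n r z (suc (suc (suc (suc (suc (suc _)))))) q c = tt

good-mono : ∀ n {M N B} → M ≤ N → Good n N B → Good n M B
good-mono n M≤N (clauses , top) =
  (λ x x<M z z<M → clause-mono M≤N _ _ z (π₁ x % 6) _ (clauses x (<-≤-trans x<M M≤N) z (<-≤-trans z<M M≤N))) ,
  (λ root< → top (<-≤-trans root< M≤N))

module _ {N} {B C : ℕ → Set} (B⇔C : ∀ x → x < N → Iff (B x) (C x)) where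

  private
    b→c : ∀ {x} → x < N → B x → C x
    b→c x<N = proj₁ (B⇔C _ x<N)
    c→b : ∀ {x} → x < N → C x → B x
    c→b x<N = proj₂ (B⇔C _ x<N)

  clause-cong : ∀ n r z tag q → pair n r < N → z < N → Clause N B n r z tag q → Clause N C n r z tag q
  clause-cong n r z 0 q x< z< c = λ eq agree → b→c z< ∘ c eq agree ∘ c→b x<
  clause-cong n r z 1 q x< z< c = λ y< → b→c y< ∘ proj₁ (c y<) ∘ c→b x< , b→c x< ∘ proj₂ (c y<) ∘ c→b y<
  clause-cong n r z 2 q x< z< c = λ y< → b→c y< ∘ proj₁ (c y<) ∘ c→b x< , b→c x< ∘ proj₂ (c y<) ∘ c→b y<
  clause-cong n r z 3 q x< z< c = λ y< →
    (λ cx cy → proj₁ (c y<) (c→b x< cx) (c→b y< cy)) ,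
    (λ ¬cy → b→c x< (proj₂ (c y<) (¬cy ∘ b→c y<)))
  clause-cong n r z 4 q x< z< c = λ u< v< →
    (λ cx → let bu , bv = proj₁ (c u< v<) (c→b x< cx) in b→c u< bu , b→c v< bv) ,
    (λ (cu , cv) → b→c x< (proj₂ (c u< v<) (c→b u< cu , c→b v< cv)))
  clause-cong n r z 5 q x< z< c =
    (λ y< → b→c y< ∘ proj₁ c y< ∘ c→b x<) ,
    (λ eq eq′ → b→c x< ∘ proj₂ c eq eq′ ∘ c→b z<)
  clause-cong n r z (suc (suc (suc (suc (suc (suc _)))))) q x< z< c = tt

  good-cong : ∀ n → Good n N B → Good n N C
  good-cong n (clauses , top) =
    (λ x x<N z z<N → clause-cong _ _ z (π₁ x % 6) _ (subst (_< N) (sym (pair-π x)) x<N) z<N (clauses x x<N z z<N)) ,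
    (λ root< → b→c root< (top root<))

good⇒clause : ∀ m {N B} → Good m N B → ∀ t q → t < 6 → ∀ r z → pair (t + 6 * q) r < N → z < N →
              Clause N B (t + 6 * q) r z t q
good⇒clause m {N} {B} good t q t<6 r z x<N z<N = reindex (proj₁ good x x<N z z<N)
  where
  n = t + 6 * q
  x = pair n r
  reindex : Clause N B (π₁ x) (π₂ x) z (π₁ x % 6) (π₁ x / 6) → Clause N B n r z t q
  reindex rewrite π₁-pair n r | π₂-pair n r | code-% t q t<6 | code-/ t q t<6 = id

-- Decidability of the matrix

bound : ℕ → ℕ
bound zero    = 0
bound (suc m) = pair 1 (bound m)

bit : Bool → ℕ
bit true  = 1
bit false = 0

bits : ℕ → (ℕ → Bool) → ℕ
bits zero    b = 0
bits (suc m) b = pair (bit (b 0)) (bits m (b ∘ suc))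

-- `bound m` codes `m` ones, the largest code of `m` bits as `pair` is monotone. The search for an
-- assignment is thereby bounded.
bits≤bound : ∀ m b → bits m b ≤ bound m
bits≤bound zero    b = z≤n
bits≤bound (suc m) b = pair-mono (bit≤1 (b 0)) (bits≤bound m (b ∘ suc))
  where
  bit≤1 : ∀ c → bit c ≤ 1
  bit≤1 true  = ≤-refl
  bit≤1 false = z≤n

nth-bits : ∀ m b x → x < m → nth (bits m b) x ≡ bit (b x)
nth-bits (suc m) b zero    _         = nth-pair (bit (b 0)) (bits m (b ∘ suc)) 0
nth-bits (suc m) b (suc x) (s≤s x<m) =
  trans (nth-pair (bit (b 0)) (bits m (b ∘ suc)) (suc x)) (nth-bits m (b ∘ suc) x x<m)

HasGoodBits : Vec ℕ 2 → Set
HasGoodBits v = ∃[ s ] (s < suc (bound (lookup v (suc zero))) ×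
                        Good (lookup v zero) (lookup v (suc zero)) (λ x → nth s x ≡ 1))

bound-computable : Computable₁ bound
bound-computable =
  curry₁ (primitive-recursion (lit 0) (app₂ pair-computable (lit 1) x₁) (λ _ → refl) (λ _ _ → refl))

closure-computable : Computable₂ closure
closure-computable =
  curry₂ (primitive-recursion x₀ (lit 5 ⊕ lit 6 ⊛ x₁) (λ _ → refl) (λ _ _ → refl))

root-computable : Computable₁ root
root-computable = curry₁ (app₂ pair-computable
  (app₂ closure-computable (app₁ arity-computable x₀) x₀) (lit 0))

⊥ᵈ : ∀ {n} → Decidable {n} (λ _ → ⊥)
⊥ᵈ = decidable-⇔ (λ _ → (λ ()) , ⊥-elim) (lit 1 ≡ᵈ lit 0)

Iffᵈ : ∀ {n} {P Q : Vec ℕ n → Set} → Decidable P → Decidable Q → Decidable (λ xs → Iff (P xs) (Q xs))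
Iffᵈ P Q = (P →ᵈ Q) ×ᵈ (Q →ᵈ P)

private
  -- `Clause` matches on its tag; an equivalent conjunction of guarded cases is what the combinators
  -- for `Decidable` can build.
  TaggedClause : (N : ℕ) (B : ℕ → Set) (n r z t q : ℕ) → Set
  TaggedClause N B n r z t q =
    (t ≡ 0 → Clause N B n r z 0 q) × (t ≡ 1 → Clause N B n r z 1 q) × (t ≡ 2 → Clause N B n r z 2 q) ×
    (t ≡ 3 → Clause N B n r z 3 q) × (t ≡ 4 → Clause N B n r z 4 q) × (t ≡ 5 → Clause N B n r z 5 q)

  tagged⇔ : ∀ N B n r z t q → Iff (TaggedClause N B n r z t q) (Clause N B n r z t q)
  tagged⇔ N B n r z 0 q = (λ c → proj₁ c refl) , λ c → (λ _ → c) , (λ ()) , (λ ()) , (λ ()) , (λ ()) , (λ ())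
  tagged⇔ N B n r z 1 q = (λ c → proj₁ (proj₂ c) refl) , λ c → (λ ()) , (λ _ → c) , (λ ()) , (λ ()) , (λ ()) , (λ ())
  tagged⇔ N B n r z 2 q =
    (λ c → proj₁ (proj₂ (proj₂ c)) refl) , λ c → (λ ()) , (λ ()) , (λ _ → c) , (λ ()) , (λ ()) , (λ ())
  tagged⇔ N B n r z 3 q =
    (λ c → proj₁ (proj₂ (proj₂ (proj₂ c))) refl) , λ c → (λ ()) , (λ ()) , (λ ()) , (λ _ → c) , (λ ()) , (λ ())
  tagged⇔ N B n r z 4 q =
    (λ c → proj₁ (proj₂ (proj₂ (proj₂ (proj₂ c)))) refl) , λ c → (λ ()) , (λ ()) , (λ ()) , (λ ()) , (λ _ → c) , (λ ())
  tagged⇔ N B n r z 5 q =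
    (λ c → proj₂ (proj₂ (proj₂ (proj₂ (proj₂ c)))) refl) , λ c → (λ ()) , (λ ()) , (λ ()) , (λ ()) , (λ ()) , (λ _ → c)
  tagged⇔ N B n r z (suc (suc (suc (suc (suc (suc _)))))) q =
    (λ _ → tt) , λ _ → (λ ()) , (λ ()) , (λ ()) , (λ ()) , (λ ()) , (λ ())

module _ {k} {N s n r z t q : Vec ℕ k → ℕ} (N# : Computable N) (s# : Computable s) (n# : Computable n)
         (r# : Computable r) (z# : Computable z) (t# : Computable t) (q# : Computable q) where

  private
    true? : ∀ {y} → Computable y → Decidable (λ xs → nth (s xs) (y xs) ≡ 1)
    true? y# = app₂ nth-computable s# y# ≡ᵈ lit 1
    _,#_ : ∀ {f g : Vec ℕ k → ℕ} → Computable f → Computable g → Computable (λ xs → pair (f xs) (g xs))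
    _,#_ = app₂ pair-computable
    x# = n# ,# r#
    y₁# = q# ,# (app₂ nth-computable r# (app₁ arity-computable q# ⊖ lit 1) ,# r#)
    y₂# = q# ,# (app₂ nth-computable r# (lit 0) ,# r#)
    y₃# = q# ,# r#
    u# = app₁ π₁-computable q# ,# app₂ drop-computable (app₁ arity-computable (app₁ π₂-computable q#)) r#
    v# = app₁ π₂-computable q# ,# r#
    y₅# = q# ,# (x# ,# r#)

  agree? : Decidable (λ xs → ∀ j → j < π₁ (q xs) → nth (r xs) j ≡ nth (π₂ (z xs)) j)
  agree? = ∀<ᵈ (app₁ π₁-computable q#)
    (app₂ nth-computable (weaken r#) x₀ ≡ᵈ app₂ nth-computable (app₁ π₂-computable (weaken z#)) x₀)

  clause? : Decidable (λ xs → Clause (N xs) (λ x → nth (s xs) x ≡ 1) (n xs) (r xs) (z xs) (t xs) (q xs))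
  clause? = decidable-⇔ (λ xs → tagged⇔ _ _ _ _ _ (t xs) _)
    ((t# ≡ᵈ lit 0 →ᵈ app₁ π₁-computable z# ≡ᵈ n# →ᵈ agree? →ᵈ true? x# →ᵈ true? z#) ×ᵈ
     (t# ≡ᵈ lit 1 →ᵈ y₁# <ᵈ N# →ᵈ Iffᵈ (true? x#) (true? y₁#)) ×ᵈ
     (t# ≡ᵈ lit 2 →ᵈ y₂# <ᵈ N# →ᵈ Iffᵈ (true? x#) (true? y₂#)) ×ᵈ
     (t# ≡ᵈ lit 3 →ᵈ y₃# <ᵈ N# →ᵈ Iffᵈ (true? x#) (true? y₃# →ᵈ ⊥ᵈ)) ×ᵈ
     (t# ≡ᵈ lit 4 →ᵈ u# <ᵈ N# →ᵈ v# <ᵈ N# →ᵈ Iffᵈ (true? x#) (true? u# ×ᵈ true? v#)) ×ᵈ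
     (t# ≡ᵈ lit 5 →ᵈ (y₅# <ᵈ N# →ᵈ true? x# →ᵈ true? y₅#) ×ᵈ
       (app₁ π₁-computable z# ≡ᵈ q# →ᵈ app₁ π₂-computable (app₁ π₂-computable z#) ≡ᵈ r# →ᵈ true? z# →ᵈ true? x#)))

hasGoodBits? : Decidable HasGoodBits
hasGoodBits? = ∃<ᵈ (app₁ suc-computable (app₁ bound-computable x₁))
  -- Under all three quantifiers `x₀` is `z`, `x₁` is `x`, `x₂` the assignment and `x₄` the bound
  -- `N`.
  (∀<ᵈ x₂ (∀<ᵈ x₃ (clause? x₄ x₂ (app₁ π₁-computable x₁) (app₁ π₂-computable x₁) x₀
      (app₁ %6-computable (app₁ π₁-computable x₁)) (app₁ /6-computable (app₁ π₁-computable x₁)))) ×ᵈ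
   (app₁ root-computable x₁ <ᵈ x₂ →ᵈ app₂ nth-computable x₀ (app₁ root-computable x₁) ≡ᵈ lit 1))
  where
  x₃ : ∀ {n} → Computable {4 + n} (λ xs → lookup xs (suc (suc (suc zero))))
  x₃ = var (suc (suc (suc zero)))
  x₄ : ∀ {n} → Computable {5 + n} (λ xs → lookup xs (suc (suc (suc (suc zero)))))
  x₄ = var (suc (suc (suc (suc zero))))

-- From consistent clauses to a model

exists : ℕ → Term → Term
exists zero    T = T
exists (suc k) T = ∃′ (exists k T)

⌜exists⌝ : ∀ k T → ⌜ exists k T ⌝ ≡ closure k ⌜ T ⌝
⌜exists⌝ zero    T = refl
⌜exists⌝ (suc k) T = cong (λ n → 5 + 6 * n) (⌜exists⌝ k T)

ar-exists : ∀ k T → ar (exists k T) ≡ ar T ∸ k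
ar-exists zero    T = refl
ar-exists (suc k) T = trans (cong pred (ar-exists k T)) (pred[m∸n]≡m∸[1+n] (ar T) k)

root-⌜⌝ : ∀ T → root ⌜ T ⌝ ≡ pair ⌜ exists (ar T) T ⌝ 0
root-⌜⌝ T = cong (λ n → pair n 0)
  (trans (cong (λ k → closure k ⌜ T ⌝) (arity-⌜⌝ T)) (sym (⌜exists⌝ (ar T) T)))

module _ (𝔄 : Model) where
  open Model 𝔄
  open Semantics 𝔄

  exists⇒Sem : ∀ k T {σ} → Sem (exists k T) σ → ∃ (Sem T)
  exists⇒Sem zero    T s = _ , s
  exists⇒Sem (suc k) T s with to (Sem-∃ (exists k T) _) s
  ... | a , s′ = exists⇒Sem k T s′

  Sem⇒exists : ∀ k T {σ} → Sem T σ → Sem (exists k T) (λ i → σ (k + i))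
  Sem⇒exists zero    T {σ} s = s
  Sem⇒exists (suc k) T {σ} s = from (Sem-∃ (exists k T) _)
    (σ k , to (Sem-≗ (exists k T) shift) (Sem⇒exists k T s))
    where
    shift : ∀ i → σ (k + i) ≡ cons (σ k) (λ i → σ (suc k + i)) i
    shift zero    = cong σ (+-identityʳ k)
    shift (suc i) = cong σ (+-suc k i)

  Sem⇒closed : ∀ T {σ} τ → Sem T σ → Sem (exists (ar T) T) τ
  Sem⇒closed T {σ} τ s = Sem-≗< (exists (ar T) T) nothing (Sem⇒exists (ar T) T s)
    where
    nothing : ∀ i → i < ar (exists (ar T) T) → σ (ar T + i) ≡ τ i
    nothing i i< with () ← subst (i <_) (trans (ar-exists (ar T) T) (n∸n≡0 (ar T))) i<

vecOf-injective : ∀ {D : Set} k {σ τ : ℕ → D} → vecOf k σ ≡ vecOf k τ → ∀ i → i < k → σ i ≡ τ i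
vecOf-injective (suc k) eq zero    _         = proj₂ (∷ʳ-injective _ _ eq)
vecOf-injective (suc k) eq (suc i) (s≤s i<k) = vecOf-injective k (proj₁ (∷ʳ-injective _ _ eq)) i i<k

module TermModel (V : ℕ → Set) {n} (good : ∀ N → ¬ ¬ Good n N V) where

  -- Many streams list the same tuple, so a symbol holds of it if `V` holds at one of them; the
  -- clauses of tag 0 make the choice immaterial.
  termModel : Model
  termModel = record
    { Dom     = ℕ
    ; element = 0
    ; interp  = λ k i v → ∃[ r ] (vecOf k (nth r) ≡ v × V (pair ⌜ rel k i ⌝ r))
    }

  open Semantics termModel

  -- Every clause is available, as `N` can exceed all variables in it; hence the levels
  -- `suc (x + y)` in `truth`.
  clause : ∀ t q → t < 6 → ∀ r z N → pair (t + 6 * q) r < N → z < N →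
           ¬ ¬ Clause N V (t + 6 * q) r z t q
  clause t q t<6 r z N x<N z<N = ¬¬-map (λ g → good⇒clause n g t q t<6 r z x<N z<N) (good N)

  private
    left< : ∀ x y → x < suc (x + y)
    left< x y = s≤s (m≤m+n x y)
    right< : ∀ x y → y < suc (x + y)
    right< x y = s≤s (m≤n+m y x)

    transfer : ∀ {A A′ X Y : Set} → A ⇔ A′ → ¬ ¬ Iff X Y → Iff (¬ A′) (¬ Y) → Iff (¬ A) (¬ X)
    transfer A⇔A′ XY A′Y =
      (λ ¬a x → XY λ (x→y , _) → proj₁ A′Y (¬a ∘ from A⇔A′) (x→y x)) ,
      (λ ¬x a → XY λ (_ , y→x) → proj₂ A′Y (¬x ∘ y→x) (to A⇔A′ a))

  -- ¬ A ⇔ ¬ B says that A and B are classically equivalent.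
  truth : ∀ T r → Iff (¬ Sem T (nth r)) (¬ V (pair ⌜ T ⌝ r))
  truth (rel k i) r = (λ ¬s v → ¬s (r , refl , v)) , λ ¬v (r′ , eq , v′) →
    let c = ⌜ rel k i ⌝ ; x = pair c r′ ; z = pair c r
    in clause 0 (pair k i) z<s r′ z (suc (x + z)) (left< x z) (right< x z) λ cl →
       ¬v (cl (π₁-pair c r)
              (λ j j<k → trans (vecOf-injective k eq j (subst (j <_) (π₁-pair k i) j<k))
                               (cong (λ s → nth s j) (sym (π₂-pair c r))))
              v′)
  truth (p′ T) r = transfer
    (mk⇔ (to (Sem-≗ T args) ∘ to (Sem-p T (nth r))) (from (Sem-p T (nth r)) ∘ from (Sem-≗ T args)))
    (¬¬-map (λ cl → cl (right< x y)) (clause 1 ⌜ T ⌝ (s<s z<s) r x (suc (x + y)) (left< x y) (left< x y)))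
    (truth T r′)
    where
    r′ = pair (nth r (arity ⌜ T ⌝ ∸ 1)) r
    x = pair ⌜ p′ T ⌝ r
    y = pair ⌜ T ⌝ r′
    args : ∀ i → cons (nth r (ar T ∸ 1)) (nth r) i ≡ nth r′ i
    args i = trans (cong (λ k → cons (nth r (k ∸ 1)) (nth r) i) (sym (arity-⌜⌝ T))) (sym (nth-pair _ r i))
  truth (I′ T) r = transfer
    (mk⇔ (to (Sem-≗ T args) ∘ to (Sem-I T (nth r))) (from (Sem-I T (nth r)) ∘ from (Sem-≗ T args)))
    (¬¬-map (λ cl → cl (right< x y)) (clause 2 ⌜ T ⌝ (s<s (s<s z<s)) r x (suc (x + y)) (left< x y) (left< x y)))
    (truth T r′)
    where
    r′ = pair (nth r 0) r
    x = pair ⌜ I′ T ⌝ r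
    y = pair ⌜ T ⌝ r′
    args : ∀ i → cons (nth r 0) (nth r) i ≡ nth r′ i
    args i = sym (nth-pair (nth r 0) r i)
  truth (¬′ T) r =
    (λ ¬¬s v → XY λ iff → ¬¬s (proj₂ (truth T r) (proj₁ iff v))) ,
    (λ ¬v ¬s → XY λ iff → ¬v (proj₂ iff (proj₁ (truth T r) ¬s)))
    where
    x = pair ⌜ ¬′ T ⌝ r
    y = pair ⌜ T ⌝ r
    XY : ¬ ¬ Iff (V x) (¬ V y)
    XY = ¬¬-map (λ cl → cl (right< x y))
      (clause 3 ⌜ T ⌝ (s<s (s<s (s<s z<s))) r x (suc (x + y)) (left< x y) (left< x y))
  truth (J′ T S) r =
    (λ ¬s v → XY λ iff → let vu , vw = proj₁ iff v in
       proj₁ (truth T (drop (ar S) r)) (λ st → proj₁ (truth S r) (λ ss → ¬s (from semJ (st , ss))) vw) vu) ,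
    (λ ¬v s → XY λ iff → let st , ss = to semJ s in
       proj₂ (truth T (drop (ar S) r)) (λ vu → proj₂ (truth S r) (λ vw → ¬v (proj₂ iff (vu , vw))) ss) st)
    where
    q = pair ⌜ T ⌝ ⌜ S ⌝
    x = pair ⌜ J′ T S ⌝ r
    u = pair (π₁ q) (drop (arity (π₂ q)) r)
    v = pair (π₂ q) r
    semJ : Sem (J′ T S) (nth r) ⇔ (Sem T (nth (drop (ar S) r)) × Sem S (nth r))
    semJ = mk⇔
      (λ s → let st , ss = to (Sem-J T S (nth r)) s in
             from (Sem-≗ T (nth-drop (ar S) r)) st , ss)
      (λ (st , ss) → from (Sem-J T S (nth r)) (to (Sem-≗ T (nth-drop (ar S) r)) st , ss))
    u-eq : u ≡ pair ⌜ T ⌝ (drop (ar S) r)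
    u-eq = cong₂ pair (π₁-pair ⌜ T ⌝ ⌜ S ⌝)
      (cong (λ k → drop k r) (trans (cong arity (π₂-pair ⌜ T ⌝ ⌜ S ⌝)) (arity-⌜⌝ S)))
    v-eq : v ≡ pair ⌜ S ⌝ r
    v-eq = cong (λ k → pair k r) (π₂-pair ⌜ T ⌝ ⌜ S ⌝)
    XY : ¬ ¬ Iff (V x) (V (pair ⌜ T ⌝ (drop (ar S) r)) × V (pair ⌜ S ⌝ r))
    XY = subst₂ (λ u v → ¬ ¬ Iff (V x) (V u × V v)) u-eq v-eq
      (¬¬-map (λ cl → cl (≤-trans (right< x u) (s≤s (m≤m+n (x + u) v))) (right< (x + u) v))
        (clause 4 q (s<s (s<s (s<s (s<s z<s)))) r x (suc (x + u + v)) x< x<))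
      where
      x< : x < suc (x + u + v)
      x< = ≤-trans (left< x u) (s≤s (m≤m+n (x + u) v))
  truth (∃′ T) r =
    -- The statement numbered `x` has `x` as its witness. Conversely, any witness `a` gives the
    -- instance `z = y a` of the clause.
    (λ ¬s v → clause 5 ⌜ T ⌝ 5<6 r x (suc (x + y x)) (left< x (y x)) (left< x (y x)) λ cl →
       proj₁ (truth T (pair x r)) (¬s ∘ some x) (proj₁ cl (right< x (y x)) v)) ,
    (λ ¬v s → let a , s′ = to (Sem-∃ T (nth r)) s in
       clause 5 ⌜ T ⌝ 5<6 r (y a) (suc (x + y a)) (left< x (y a)) (right< x (y a)) λ cl →
       proj₂ (truth T (pair a r))
         (λ vy → ¬v (proj₂ cl (π₁-pair _ _) (trans (cong π₂ (π₂-pair ⌜ T ⌝ (pair a r))) (π₂-pair a r)) vy))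
         (to (Sem-≗ T (λ i → sym (nth-pair a r i))) s′))
    where
    5<6 = s<s (s<s (s<s (s<s (s<s z<s))))
    x = pair ⌜ ∃′ T ⌝ r
    y : ℕ → ℕ
    y a = pair ⌜ T ⌝ (pair a r)
    some : ∀ a → Sem T (nth (pair a r)) → Sem (∃′ T) (nth r)
    some a s = from (Sem-∃ T (nth r)) (a , to (Sem-≗ T (nth-pair a r)) s)

  root-true : ¬ ¬ V (root n)
  root-true = ¬¬-map (λ g → proj₂ g (n<1+n (root n))) (good (suc (root n)))

isOne : ℕ → Bool
isOne 1 = true
isOne _ = false

isOne-⇔ : ∀ k → Iff (k ≡ 1) (isOne k ≡ true)
isOne-⇔ 0             = (λ ()) , (λ ())
isOne-⇔ 1             = const refl , const refl
isOne-⇔ (suc (suc _)) = (λ ()) , (λ ())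

GoodBool : (n N : ℕ) → (ℕ → Bool) → Set
GoodBool n N b = Good n N (λ x → b x ≡ true)

goodBits⇒goodBool : ∀ n N → HasGoodBits (n ∷ N ∷ []) → ∃ (GoodBool n N)
goodBits⇒goodBool n N (s , _ , g) = isOne ∘ nth s , good-cong (λ x _ → isOne-⇔ (nth s x)) n g

goodBits⇒SAT : ∀ n → (∀ m → HasGoodBits (n ∷ m ∷ [])) → SAT n
goodBits⇒SAT n h with ⌜⌝-surjective n
... | T , refl = T , refl , termModel , from (≢∅⇔¬¬Sem T) λ none →
  subst (¬_ ∘ ¬_ ∘ Path) (root-⌜⌝ T) root-true
    (proj₁ (truth (exists (ar T) T) 0) (none ∘ exists⇒Sem termModel (ar T) T))
  where
  open Compactness (GoodBool n) (good-mono n) (λ N → goodBits⇒goodBool n N (h N))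
  goodPath : ∀ N → ¬ ¬ Good n N Path
  goodPath N = ¬¬-map
    (λ (b , g , d) → good-cong (λ x x<N → proj₂ (d x x<N) , proj₁ (d x x<N)) n g) (compactness N)
  open TermModel Path {n} goodPath
  open Semantics termModel

-- From a model to consistent clauses

module HenkinWitnesses (𝔄 : Model) where
  open Model 𝔄
  open Semantics 𝔄

  WitnessAt : (ℕ → Dom) → ℕ → Set
  WitnessAt e w = ∀ T → π₁ w ≡ ⌜ ∃′ T ⌝ → ∃[ a ] Sem T (cons a (e ∘ nth (π₂ w))) →
                  Sem T (cons (e w) (e ∘ nth (π₂ w)))

  update : (ℕ → Dom) → ℕ → Dom → ℕ → Dom
  update e w a i with i ≟ w
  ... | yes _ = a
  ... | no  _ = e i

  update-at : ∀ e w a → update e w a w ≡ a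
  update-at e w a with w ≟ w
  ... | yes _   = refl
  ... | no  w≢w = contradiction refl w≢w

  update-below : ∀ e w a i → i < w → update e w a i ≡ e i
  update-below e w a i i<w with i ≟ w
  ... | yes refl = contradiction i<w (<-irrefl refl)
  ... | no  _    = refl

  -- The witness for `w` is chosen after all its parameters, and a later `update` leaves them alone.
  -- Strictness comes from the code of an existential term being positive.
  parameter< : ∀ w T → π₁ w ≡ ⌜ ∃′ T ⌝ → ∀ i → nth (π₂ w) i < w
  parameter< w T eq i = ≤-<-trans (nth≤ (π₂ w) i) (begin-strict
    π₂ w             <⟨ m<n+m (π₂ w) (subst (0 <_) (sym eq) z<s) ⟩
    π₁ w + π₂ w      ≤⟨ +≤pair (π₁ w) (π₂ w) ⟩
    pair (π₁ w) (π₂ w) ≡⟨ pair-π w ⟩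
    w                ∎)
    where open ≤-Reasoning

  cons-cong : ∀ {a b : Dom} {σ τ : ℕ → Dom} → a ≡ b → (∀ i → σ i ≡ τ i) → ∀ i → cons a σ i ≡ cons b τ i
  cons-cong a≡b σ≗τ zero    = a≡b
  cons-cong a≡b σ≗τ (suc i) = σ≗τ i

  witnessAt-cong : ∀ {e e′} w → (∀ i → i < suc w → e i ≡ e′ i) → WitnessAt e w → WitnessAt e′ w
  witnessAt-cong {e} {e′} w e≗e′ wit T eq (a , s) =
    to (Sem-≗ T (cons-cong (e≗e′ w ≤-refl) same)) (wit T eq (a , from (Sem-≗ T (cons-cong refl same)) s))
    where
    same : ∀ i → e (nth (π₂ w) i) ≡ e′ (nth (π₂ w) i)
    same i = e≗e′ _ (m≤n⇒m≤1+n (parameter< w T eq i))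

  -- The drinker principle, up to double negation: a witness if there is one, and `element`
  -- otherwise.
  some-witness : ∀ e w → ¬ ¬ (∃[ a ] (∀ T → π₁ w ≡ ⌜ ∃′ T ⌝ → ∃[ b ] Sem T (cons b (e ∘ nth (π₂ w))) →
                                      Sem T (cons a (e ∘ nth (π₂ w)))))
  some-witness e w with ⌜⌝-surjective (π₁ w)
  ... | U , eqU = go U eqU
    where
    σ = e ∘ nth (π₂ w)
    Good-witness : Term → Dom → Set
    Good-witness U a = ∀ T → π₁ w ≡ ⌜ ∃′ T ⌝ → ∃[ b ] Sem T (cons b σ) → Sem T (cons a σ)
    is : ∀ U T → ⌜ U ⌝ ≡ π₁ w → π₁ w ≡ ⌜ ∃′ T ⌝ → U ≡ ∃′ T
    is U T eqU eq = ⌜⌝-injective {U} {∃′ T} (trans eqU eq)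
    go : ∀ U → ⌜ U ⌝ ≡ π₁ w → ¬ ¬ ∃ (Good-witness U)
    go (∃′ U) eqU = ¬¬-LEM {∃[ b ] Sem U (cons b σ)}
      (λ (b , s) k → k (b , λ T eq _ → subst (λ T → Sem T (cons b σ)) (∃-injective U T (is (∃′ U) T eqU eq)) s))
      (λ ¬s k → k (element , λ T eq s → contradiction (subst (λ T → ∃[ b ] Sem T (cons b σ)) (sym (∃-injective U T (is (∃′ U) T eqU eq))) s) ¬s))
      where
      ∃-injective : ∀ T S → ∃′ T ≡ ∃′ S → T ≡ S
      ∃-injective T .T refl = refl
    go U@(rel _ _) eqU k = k (element , λ T eq → contradiction (is U T eqU eq) λ ())
    go U@(p′ _)    eqU k = k (element , λ T eq → contradiction (is U T eqU eq) λ ())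
    go U@(I′ _)    eqU k = k (element , λ T eq → contradiction (is U T eqU eq) λ ())
    go U@(¬′ _)    eqU k = k (element , λ T eq → contradiction (is U T eqU eq) λ ())
    go U@(J′ _ _)  eqU k = k (element , λ T eq → contradiction (is U T eqU eq) λ ())

  witnesses : ∀ N → ¬ ¬ (∃[ e ] (∀ w → w < N → WitnessAt e w))
  witnesses zero    k = k (const element , λ _ ())
  witnesses (suc N) k = witnesses N λ (e , wit) → some-witness e N λ (a , ok) →
    k (update e N a , λ w w<1+N → extend e wit a ok w (m≤n⇒m<n∨m≡n (≤-pred w<1+N)))
    where
    extend : ∀ e → (∀ w → w < N → WitnessAt e w) → ∀ a →
             (∀ T → π₁ N ≡ ⌜ ∃′ T ⌝ → ∃[ b ] Sem T (cons b (e ∘ nth (π₂ N))) → Sem T (cons a (e ∘ nth (π₂ N)))) →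
             ∀ w → w < N ⊎ w ≡ N → WitnessAt (update e N a) w
    extend e wit a ok w (inj₁ w<N) =
      witnessAt-cong w (λ i i≤w → sym (update-below e N a i (<-≤-trans i≤w w<N))) (wit w w<N)
    extend e wit a ok w (inj₂ refl) T eq (b , s) =
      to (Sem-≗ T (cons-cong (sym (update-at e w a)) same))
         (ok T eq (b , from (Sem-≗ T (cons-cong refl same)) s))
      where
      same : ∀ i → e (nth (π₂ w) i) ≡ update e w a (nth (π₂ w) i)
      same i = sym (update-below e w a _ (parameter< w T eq i))

  True : (ℕ → Dom) → ℕ → Set
  True e x = Sem (decode (π₁ x)) (e ∘ nth (π₂ x))

  true-⌜⌝ : ∀ e T r → True e (pair ⌜ T ⌝ r) ⇔ Sem T (e ∘ nth r)
  true-⌜⌝ e T r rewrite π₁-pair ⌜ T ⌝ r | π₂-pair ⌜ T ⌝ r | decode-⌜⌝ T = mk⇔ id id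

  module _ (e : ℕ → Dom) (N : ℕ) (wit : ∀ w → w < N → WitnessAt e w) where

    clause-true : ∀ T r z → pair ⌜ T ⌝ r < N →
                  Clause N (True e) ⌜ T ⌝ r z (⌜ T ⌝ % 6) (⌜ T ⌝ / 6)
    clause-true T r z x<N = go T x<N
      where
      reindex : ∀ T t q → t < 6 → ⌜ T ⌝ ≡ t + 6 * q → Clause N (True e) ⌜ T ⌝ r z t q →
                Clause N (True e) ⌜ T ⌝ r z (⌜ T ⌝ % 6) (⌜ T ⌝ / 6)
      reindex T t q t<6 eq = subst₂ (Clause N (True e) ⌜ T ⌝ r z)
        (sym (trans (cong (_% 6) eq) (code-% t q t<6))) (sym (trans (cong (_/ 6) eq) (code-/ t q t<6)))
      iff : ∀ T S r′ → Sem T (e ∘ nth r) ⇔ Sem S (e ∘ nth r′) →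
            Iff (True e (pair ⌜ T ⌝ r)) (True e (pair ⌜ S ⌝ r′))
      iff T S r′ T⇔S =
        from (true-⌜⌝ e S r′) ∘ to T⇔S ∘ to (true-⌜⌝ e T r) ,
        from (true-⌜⌝ e T r) ∘ from T⇔S ∘ to (true-⌜⌝ e S r′)
      cons-nth : ∀ a i → cons (e a) (e ∘ nth r) i ≡ e (nth (pair a r) i)
      cons-nth a zero    = cong e (sym (nth-pair a r 0))
      cons-nth a (suc i) = cong e (sym (nth-pair a r (suc i)))
      go : ∀ T → pair ⌜ T ⌝ r < N → Clause N (True e) ⌜ T ⌝ r z (⌜ T ⌝ % 6) (⌜ T ⌝ / 6)
      go (rel k i) x<N = reindex (rel k i) 0 (pair k i) z<s refl λ eq agree s →
        subst (True e) (trans (cong (λ n → pair n (π₂ z)) (sym eq)) (pair-π z))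
          (from (true-⌜⌝ e (rel k i) (π₂ z))
            (Sem-≗< (rel k i) (λ j j<k → cong e (agree j (subst (j <_) (sym (π₁-pair k i)) j<k)))
              (to (true-⌜⌝ e (rel k i) r) s)))
      go (p′ T) x<N = reindex (p′ T) 1 ⌜ T ⌝ (s<s z<s) refl λ _ → iff (p′ T) T _
        (mk⇔ (to args ∘ to (Sem-p T _)) (from (Sem-p T _) ∘ from args))
        where
        args = Sem-≗ T λ i → trans (cong (λ k → cons (e (nth r (k ∸ 1))) (e ∘ nth r) i) (sym (arity-⌜⌝ T)))
                                   (cons-nth (nth r (arity ⌜ T ⌝ ∸ 1)) i)
      go (I′ T) x<N = reindex (I′ T) 2 ⌜ T ⌝ (s<s (s<s z<s)) refl λ _ → iff (I′ T) T _
        (mk⇔ (to args ∘ to (Sem-I T _)) (from (Sem-I T _) ∘ from args))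
        where
        args = Sem-≗ T (cons-nth (nth r 0))
      go (¬′ T) x<N = reindex (¬′ T) 3 ⌜ T ⌝ (s<s (s<s (s<s z<s))) refl λ _ →
        (λ s t → to (true-⌜⌝ e (¬′ T) r) s (to (true-⌜⌝ e T r) t)) ,
        (λ ¬t → from (true-⌜⌝ e (¬′ T) r) (¬t ∘ from (true-⌜⌝ e T r)))
      go (J′ T S) x<N = reindex (J′ T S) 4 q (s<s (s<s (s<s (s<s z<s)))) refl λ _ _ →
        (λ s → let st , ss = to (Sem-J T S _) (to (true-⌜⌝ e (J′ T S) r) s) in
          subst (True e) (sym u-eq) (from (true-⌜⌝ e T _) (to args st)) ,
          subst (True e) (sym v-eq) (from (true-⌜⌝ e S r) ss)) ,
        (λ (tu , tv) → from (true-⌜⌝ e (J′ T S) r) (from (Sem-J T S _)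
          (from args (to (true-⌜⌝ e T _) (subst (True e) u-eq tu)) ,
           to (true-⌜⌝ e S r) (subst (True e) v-eq tv))))
        where
        q = pair ⌜ T ⌝ ⌜ S ⌝
        args : Sem T (λ i → e (nth r (ar S + i))) ⇔ Sem T (e ∘ nth (drop (ar S) r))
        args = Sem-≗ T λ i → cong e (sym (nth-drop (ar S) r i))
        u-eq : pair (π₁ q) (drop (arity (π₂ q)) r) ≡ pair ⌜ T ⌝ (drop (ar S) r)
        u-eq = cong₂ pair (π₁-pair ⌜ T ⌝ ⌜ S ⌝)
          (cong (λ k → drop k r) (trans (cong arity (π₂-pair ⌜ T ⌝ ⌜ S ⌝)) (arity-⌜⌝ S)))
        v-eq : pair (π₂ q) r ≡ pair ⌜ S ⌝ r
        v-eq = cong (λ k → pair k r) (π₂-pair ⌜ T ⌝ ⌜ S ⌝)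
      go (∃′ T) x<N = reindex (∃′ T) 5 ⌜ T ⌝ (s<s (s<s (s<s (s<s (s<s z<s))))) refl
        ( (λ _ s → from (true-⌜⌝ e T _) (to (Sem-≗ T (cons-nth x)) (holds (to (true-⌜⌝ e (∃′ T) r) s))))
        , (λ eq eq′ s → from (true-⌜⌝ e (∃′ T) r) (from (Sem-∃ T _) (e (π₁ (π₂ z)) ,
            from (Sem-≗ T (cons-nth (π₁ (π₂ z)))) (to (true-⌜⌝ e T _) (subst (True e) (z-eq eq eq′) s))))))
        where
        x = pair ⌜ ∃′ T ⌝ r
        holds : Sem (∃′ T) (e ∘ nth r) → Sem T (cons (e x) (e ∘ nth r))
        holds s = subst (λ r → Sem T (cons (e x) (e ∘ nth r))) (π₂-pair ⌜ ∃′ T ⌝ r)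
          (wit x x<N T (π₁-pair ⌜ ∃′ T ⌝ r)
            (subst (λ r → ∃[ a ] Sem T (cons a (e ∘ nth r))) (sym (π₂-pair ⌜ ∃′ T ⌝ r)) (to (Sem-∃ T _) s)))
        z-eq : π₁ z ≡ ⌜ T ⌝ → π₂ (π₂ z) ≡ r → z ≡ pair ⌜ T ⌝ (pair (π₁ (π₂ z)) r)
        z-eq eq eq′ = trans (sym (pair-π z)) (cong₂ pair eq
          (trans (sym (pair-π (π₂ z))) (cong (pair (π₁ (π₂ z))) eq′)))

    good-true : ∀ T → ∃ (Sem T) → Good ⌜ T ⌝ N (True e)
    good-true T (σ , s) =
      (λ x x<N z _ → clauseAt x x<N z (⌜⌝-surjective (π₁ x))) ,
      (λ _ → subst (True e) (sym (root-⌜⌝ T))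
               (from (true-⌜⌝ e (exists (ar T) T) 0) (Sem⇒closed 𝔄 T (e ∘ nth 0) s)))
      where
      clauseAt : ∀ x → x < N → ∀ z → ∃[ U ] ⌜ U ⌝ ≡ π₁ x →
                 Clause N (True e) (π₁ x) (π₂ x) z (π₁ x % 6) (π₁ x / 6)
      clauseAt x x<N z (U , eq) = subst (λ n → Clause N (True e) n (π₂ x) z (n % 6) (n / 6)) eq
        (clause-true U (π₂ x) z (subst (_< N) (trans (sym (pair-π x)) (cong (λ n → pair n (π₂ x)) (sym eq))) x<N))

-- Witnesses and truth values below `m` exist only up to double negation, which the decidable
-- conclusion allows to drop.
satisfiable⇒goodBits : ∀ T → Satisfiable T → ∀ m → HasGoodBits (⌜ T ⌝ ∷ m ∷ [])
satisfiable⇒goodBits T (𝔄 , ≢∅) m = decidable-stable (dec hasGoodBits? (⌜ T ⌝ ∷ m ∷ [])) λ ¬good →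
  to (≢∅⇔¬¬Sem T) ≢∅ λ s → witnesses m λ (e , wit) → finite-LEM m (True e) λ (b , iff) →
  ¬good (bits m b , s≤s (bits≤bound m b) , good-cong (bits-true e b iff) ⌜ T ⌝ (good-true e m wit T s))
  where
  open HenkinWitnesses 𝔄
  open Semantics 𝔄
  bit-injective : ∀ c → bit c ≡ 1 → c ≡ true
  bit-injective true _ = refl
  bits-true : ∀ e b → DecidesBelow m (True e) b → ∀ x → x < m → Iff (True e x) (nth (bits m b) x ≡ 1)
  bits-true e b iff x x<m = (λ t → trans eq (cong bit (proj₁ (iff x x<m) t))) ,
                            (λ one → proj₂ (iff x x<m) (bit-injective (b x) (trans (sym eq) one)))
    where
    eq : nth (bits m b) x ≡ bit (b x)
    eq = nth-bits m b x x<m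

SAT-Π₁⁰ : Π₁⁰ SAT
SAT-Π₁⁰ = HasGoodBits , decidable⇒computableRel hasGoodBits? , λ n → mk⇔
  (λ { (T , refl , sat) → satisfiable⇒goodBits T sat })
  (goodBits⇒SAT n)

-- Binary relations definable with p, I, ¬, J and ∃

data Expr : Set where
  symbol  : ℕ → Expr
  _⨾_ _∩_ : Expr → Expr → Expr
  _˘ ∁_   : Expr → Expr

infixr 7 _⨾_
infixr 6 _∩_
infix  9 _˘ ∁_

module _ {D : Set} (ρ : ℕ → D → D → Set) where

  den : Expr → D → D → Set
  den (symbol i) x y = ρ i x y
  den (R ⨾ S) x z = ∃[ y ] (den R x y × den S y z)
  den (R ∩ S) x y = den R x y × den S x y
  den (R ˘)   x y = den R y x
  den (∁ R)   x y = ¬ den R x y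

-- Without swaps only cyclic rotations and identifications of cyclically adjacent
-- arguments are at hand, so these terms rest on the fact that the diagrams of ⨾ and ∩
-- can be drawn in the plane.
term : Expr → Term
term (symbol i) = rel 2 i
term (R ⨾ S) = p′ (∃′ (I′ (p′ (J′ (term R) (term S)))))
term (R ∩ S) = p′ (I′ (p′ (I′ (p′ (J′ (term R) (p′ (term S)))))))
term (R ˘)   = p′ (term R)
term (∁ R)   = ¬′ (term R)

ar-term : ∀ R → ar (term R) ≡ 2
ar-term (symbol i) = refl
ar-term (R ⨾ S) rewrite ar-term R | ar-term S = refl
ar-term (R ∩ S) rewrite ar-term R | ar-term S = refl
ar-term (R ˘)   = ar-term R
ar-term (∁ R)   = ar-term R

isEmpty isTotal : Expr → Term
isEmpty R = ¬′ (∃′ (∃′ (term R)))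
isTotal R = ¬′ (∃′ (¬′ (∃′ (term R))))

Empty Total : ∀ {D : Set} (ρ : ℕ → D → D → Set) → Expr → Set
Empty ρ R = ∀ x y → ¬ den ρ R x y
Total ρ R = ∀ x → ¬ ¬ (∃[ y ] den ρ R x y)

module ExprSemantics (𝔄 : Model) where
  open Model 𝔄
  open Semantics 𝔄

  rels : ℕ → Dom → Dom → Set
  rels i x y = interp 2 i (x ∷ y ∷ [])

  private
    Sem-pₖ : ∀ T {k} → ar T ≡ k → ∀ σ → Sem (p′ T) σ ⇔ Sem T (cons (σ (k ∸ 1)) σ)
    Sem-pₖ T refl = Sem-p T

    Sem-Jₖ : ∀ T S {l} → ar S ≡ l → ∀ σ → Sem (J′ T S) σ ⇔ (Sem T (λ i → σ (l + i)) × Sem S σ)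
    Sem-Jₖ T S refl = Sem-J T S

  -- For `⨾`, `J′` gives `(x, y, y′, z)`; rotation to `(z, x, y, y′)` lets `I′` identify and `∃′`
  -- remove the middle, leaving `(z, x)`. For `∩`, `J′` gives `(x, y, y′, x′)`; one rotation makes
  -- `y`, `y′` the last two, a second one `x′`, `x`. The final rotation restores the order.
  Sem-term : ∀ R σ → Sem (term R) σ ⇔ den rels R (σ 1) (σ 0)
  Sem-term (symbol i) σ = mk⇔ id id
  Sem-term (R ⨾ S) σ = mk⇔
    (λ s → let a , s′ = to (Sem-∃ (I′ pJ) _) (to (Sem-pₖ (∃′ (I′ pJ)) ar₂ σ) s)
               r , t = to (Sem-Jₖ (term R) (term S) (ar-term S) _) (to (Sem-pₖ J ar₄ _) (to (Sem-I pJ _) s′))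
           in a , to (Sem-term R _) r , to (Sem-term S _) t)
    (λ (a , r , t) → from (Sem-pₖ (∃′ (I′ pJ)) ar₂ σ) (from (Sem-∃ (I′ pJ) _) (a ,
      from (Sem-I pJ _) (from (Sem-pₖ J ar₄ _)
        (from (Sem-Jₖ (term R) (term S) (ar-term S) _) (from (Sem-term R _) r , from (Sem-term S _) t))))))
    where
    J pJ : Term
    J = J′ (term R) (term S)
    pJ = p′ J
    ar₄ : ar J ≡ 4
    ar₄ = cong₂ _+_ (ar-term R) (ar-term S)
    ar₂ : ar (∃′ (I′ pJ)) ≡ 2
    ar₂ = cong (pred ∘ arI) ar₄
  Sem-term (R ∩ S) σ = mk⇔
    (λ s → let r , t = to (Sem-Jₖ (term R) pS (ar-term S) _) (to (Sem-pₖ J ar₄ _) (to (Sem-I pJ _)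
                         (to (Sem-pₖ IpJ ar₃ _) (to (Sem-I (p′ IpJ) _) (to (Sem-pₖ (I′ (p′ IpJ)) ar₂ σ) s)))))
           in to (Sem-term R _) r , to (Sem-term S _) (to (Sem-pₖ (term S) (ar-term S) _) t))
    (λ (r , t) → from (Sem-pₖ (I′ (p′ IpJ)) ar₂ σ) (from (Sem-I (p′ IpJ) _) (from (Sem-pₖ IpJ ar₃ _)
      (from (Sem-I pJ _) (from (Sem-pₖ J ar₄ _) (from (Sem-Jₖ (term R) pS (ar-term S) _)
        (from (Sem-term R _) r , from (Sem-pₖ (term S) (ar-term S) _) (from (Sem-term S _) t))))))))
    where
    pS J pJ IpJ : Term
    pS = p′ (term S)
    J = J′ (term R) pS
    pJ = p′ J
    IpJ = I′ pJ
    ar₄ : ar J ≡ 4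
    ar₄ = cong₂ _+_ (ar-term R) (ar-term S)
    ar₃ : ar IpJ ≡ 3
    ar₃ = cong arI ar₄
    ar₂ : ar (I′ (p′ IpJ)) ≡ 2
    ar₂ = cong arI ar₃
  Sem-term (R ˘) σ = mk⇔
    (λ s → to (Sem-term R _) (to (Sem-pₖ (term R) (ar-term R) σ) s))
    (λ s → from (Sem-pₖ (term R) (ar-term R) σ) (from (Sem-term R _) s))
  Sem-term (∁ R) σ = mk⇔ (λ ¬s → ¬s ∘ from (Sem-term R σ)) (λ ¬s → ¬s ∘ to (Sem-term R σ))

  Sem-isEmpty : ∀ R σ → Sem (isEmpty R) σ ⇔ Empty rels R
  Sem-isEmpty R σ = mk⇔
    (λ ¬s x y d → ¬s (from (Sem-∃ (∃′ (term R)) σ) (x , from (Sem-∃ (term R) _) (y , from (Sem-term R _) d))))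
    (λ empty s → let x , s′ = to (Sem-∃ (∃′ (term R)) σ) s
                     y , s″ = to (Sem-∃ (term R) _) s′
                 in empty x y (to (Sem-term R _) s″))

  Sem-isTotal : ∀ R σ → Sem (isTotal R) σ ⇔ Total rels R
  Sem-isTotal R σ = mk⇔
    (λ ¬s x none → ¬s (from (Sem-∃ (¬′ (∃′ (term R))) σ) (x , λ s →
       let y , s′ = to (Sem-∃ (term R) _) s in none (y , to (Sem-term R _) s′))))
    (λ total s → let x , ¬s = to (Sem-∃ (¬′ (∃′ (term R))) σ) s in
       total x λ (y , d) → ¬s (from (Sem-∃ (term R) _) (y , from (Sem-term R _) d)))

-- Axiomatising μ-recursive functions

-- Elements serve both as numbers and as argument lists. In the intended model with
-- domain ℕ, hd and tl are π₁ and π₂, so a list may be followed by arbitrary junk.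
Z S hd tl one : Expr
Z   = symbol 0
S   = symbol 1
hd  = symbol 2
tl  = symbol 3
one = hd ˘ ⨾ tl

_∖_ : Expr → Expr → Expr
R ∖ Q = R ∩ ∁ Q

infix 5 _∖_

-- The least fixed points behind prec and mu each get a relation symbol of their own;
-- fixpoints lists their intended meanings, in the order of the symbols.

vecFrom : ∀ n → ℕ → Vec ℕ n
vecFrom zero    t = []
vecFrom (suc n) t = π₁ t ∷ vecFrom n (π₂ t)

PrecGraph : ∀ {n} → Rec n → Rec (2 + n) → ℕ → ℕ → Set
PrecGraph g h t y = prec g h [ vecFrom _ t ]⇓ y

-- A property of `t` in the shape of a binary relation with arbitrary second argument, the shape
-- that `⨾ one` also produces.
NonzeroBelow : ∀ {n} → Rec (suc n) → ℕ → ℕ → Set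
NonzeroBelow f t _ = ∀ i → i < π₁ t → ∃[ v ] f [ i ∷ vecFrom _ (π₂ t) ]⇓ suc v

mutual
  fixpoints : ∀ {n} → Rec n → List (ℕ → ℕ → Set)
  fixpoints zer         = []
  fixpoints succ        = []
  fixpoints (proj j)    = []
  fixpoints (comp f gs) = fixpoints* gs List.++ fixpoints f
  fixpoints (prec g h)  = PrecGraph g h ∷ fixpoints g List.++ fixpoints h
  fixpoints (mu f)      = NonzeroBelow f ∷ fixpoints f

  fixpoints* : ∀ {m n} → Vec (Rec n) m → List (ℕ → ℕ → Set)
  fixpoints* []       = []
  fixpoints* (g ∷ gs) = fixpoints g List.++ fixpoints* gs

size : ∀ {n} → Rec n → ℕ
size c = length (fixpoints c)

size* : ∀ {m n} → Vec (Rec n) m → ℕ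
size* gs = length (fixpoints* gs)

-- Relates x + 1 ∷ xs to x ∷ xs.
decrement : Expr
decrement = (hd ⨾ S ˘ ⨾ hd ˘) ∩ (tl ⨾ tl ˘)

-- Relates x ∷ xs to x ∷ r ∷ xs whenever P relates x ∷ xs to r.
insertValue : Expr → Expr
insertValue P = (hd ⨾ hd ˘) ∩ (tl ⨾ tl ˘ ⨾ tl ˘) ∩ (P ⨾ hd ˘ ⨾ tl ˘)

nth-entry : ∀ {n} → Fin n → Expr
nth-entry zero    = hd
nth-entry (suc j) = tl ⨾ nth-entry j

mutual
  graph : ∀ {n} → Rec n → ℕ → Expr
  graph zer         i = Z
  graph succ        i = hd ⨾ S
  graph (proj j)    i = nth-entry j
  graph (comp f gs) i = graph* gs i ⨾ graph f (i + size* gs)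
  -- Symbols 0 to 3 are `Z`, `S`, `hd` and `tl`.
  graph (prec g h)  i = symbol (4 + i)
  -- `tl ˘` guesses the list `y ∷ xs`, whose head is the result.
  graph (mu f)      i = tl ˘ ⨾ (hd ∩ symbol (4 + i) ∩ (graph f (suc i) ⨾ Z ˘ ⨾ one))

  graph* : ∀ {m n} → Vec (Rec n) m → ℕ → Expr
  -- Every element represents the empty list; `Z`, being total, provides one.
  graph* []       i = Z
  graph* (g ∷ gs) i = (graph g i ⨾ hd ˘) ∩ (graph* gs (i + size g) ⨾ tl ˘)

-- Emptiness of a difference is an inclusion, so these are the closure conditions of an inductive
-- definition.
precBase precStep : ∀ {n} → Rec n → Rec (2 + n) → ℕ → Expr
precBase g h i = (hd ⨾ Z ˘ ⨾ one) ∩ (tl ⨾ graph g (suc i)) ∖ symbol (4 + i)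
precStep g h i =
  decrement ⨾ insertValue (symbol (4 + i)) ⨾ graph h (suc i + size g) ∖ symbol (4 + i)

muBase muStep : ∀ {n} → Rec (suc n) → ℕ → Expr
muBase f i = hd ⨾ Z ˘ ⨾ one ∖ symbol (4 + i)
muStep f i = decrement ⨾ (symbol (4 + i) ∩ (graph f (suc i) ⨾ S ˘ ⨾ one)) ∖ symbol (4 + i)

mutual
  axioms : ∀ {n} → Rec n → ℕ → List Expr
  axioms zer         i = []
  axioms succ        i = []
  axioms (proj j)    i = []
  axioms (comp f gs) i = axioms* gs i List.++ axioms f (i + size* gs)
  axioms (prec g h)  i =
    precBase g h i ∷ precStep g h i ∷ axioms g (suc i) List.++ axioms h (suc i + size g)
  axioms (mu f)      i = muBase f i ∷ muStep f i ∷ axioms f (suc i)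

  axioms* : ∀ {m n} → Vec (Rec n) m → ℕ → List Expr
  axioms* []       i = []
  axioms* (g ∷ gs) i = axioms g i List.++ axioms* gs (i + size g)

numeral : ℕ → Expr
numeral zero    = Z
numeral (suc n) = numeral n ⨾ S

-- Every model of the axioms contains all computations

module Adequacy {D : Set} (ρ : ℕ → D → D → Set) (element : D)
                (total-Z : Total ρ Z) (total-S : Total ρ S) (full : Empty ρ (∁ one)) where

  -- A number may have many representatives and an element may represent several numbers; what
  -- matters is a chain of `S`-steps from a value of `Z`.
  Num : ℕ → D → Set
  Num n a = ∃[ s ] den ρ (numeral n) s a

  Rep : ∀ {n} → Vec ℕ n → D → Set
  Rep []       t = ⊤
  Rep (x ∷ xs) t = ∃₂ λ a u → den ρ hd t a × den ρ tl t u × Num x a × Rep xs u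

  included : ∀ R Q → Empty ρ (R ∖ Q) → ∀ {x y} → den ρ R x y → ¬ ¬ den ρ Q x y
  included R Q empty r ¬q = empty _ _ (r , ¬q)

  num-suc : ∀ x {a b} → Num x a → den ρ S a b → Num (suc x) b
  num-suc x (s , n) ab = s , _ , n , ab

  num-exists : ∀ n → ¬ ¬ ∃ (Num n)
  num-exists zero    k = total-Z element λ (a , z) → k (a , element , z)
  num-exists (suc n) k = num-exists n λ (a , na) → total-S a λ (b , ab) → k (b , num-suc n na ab)

  rep-exists : ∀ {n} (xs : Vec ℕ n) → ¬ ¬ ∃ (Rep xs)
  rep-exists []       k = k (element , tt)
  rep-exists (x ∷ xs) k = num-exists x λ (a , na) → rep-exists xs λ (u , ru) →
    full a u λ (t , ta , tu) → k (t , a , u , ta , tu , na , ru)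

  Computes : ∀ {n} → Rec n → ℕ → Vec ℕ n → ℕ → Set
  Computes c i xs y = ∀ t → Rep xs t → ¬ ¬ (∃[ b ] (Num y b × den ρ (graph c i) t b))

  proj-computes : ∀ {n} j (xs : Vec ℕ n) → Computes (proj j) 0 xs (lookup xs j)
  proj-computes zero    (x ∷ xs) t (a , u , ta , tu , na , ru) k = k (a , na , ta)
  proj-computes (suc j) (x ∷ xs) t (a , u , ta , tu , na , ru) k =
    proj-computes j xs u ru λ (b , nb , ub) → k (b , nb , u , tu , ub)

  -- The induction hypothesis is an argument, so that `computes` visibly recurses on the
  -- subderivations.
  comp-computes : ∀ {m n} (gs : Vec (Rec n) m) zs (xs : Vec ℕ n) i → All (Empty ρ) (axioms* gs i) →
    (∀ j i → All (Empty ρ) (axioms (lookup gs j) i) → Computes (lookup gs j) i xs (lookup zs j)) →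
    ∀ t → Rep xs t → ¬ ¬ (∃[ u ] (Rep zs u × den ρ (graph* gs i) t u))
  comp-computes []       []       xs i ax ih t r k = total-Z t λ (u , tu) → k (u , tt , tu)
  comp-computes (g ∷ gs) (z ∷ zs) xs i ax ih t r k =
    ih zero i (++⁻ˡ (axioms g i) ax) t r λ (b , nb , tb) →
    comp-computes gs zs xs (i + size g) (++⁻ʳ (axioms g i) ax) (ih ∘ suc) t r λ (u , ru , tu) →
    full b u λ (w , wb , wu) → k (w , (b , u , wb , wu , nb , ru) , (b , tb , wb) , (u , tu , wu))

  module _ {n} (f : Rec (suc n)) i (base : Empty ρ (muBase f i)) (step : Empty ρ (muStep f i))
           (xs : Vec ℕ n) where

    -- Induction along the chain inside `Num`: its last step names a predecessor `b` of the head,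
    -- and `full` yields a list with head `b` and the same tail, to which the step axiom applies.
    nonzero-below : ∀ y → (∀ x → x < y → ∃[ v ] Computes f (suc i) (x ∷ xs) (suc v)) →
                    ∀ t a u → den ρ hd t a → den ρ tl t u → Num y a → Rep xs u →
                    ∀ s → ¬ ¬ den ρ (symbol (4 + i)) t s
    nonzero-below zero below t a u ta tu (z , za) ru s k = full z s λ zs →
      included (hd ⨾ Z ˘ ⨾ one) (symbol (4 + i)) base (a , ta , z , za , zs) k
    nonzero-below (suc y) below t a u ta tu (z , b , nb , ba) ru s k =
      full b u λ (t′ , t′b , t′u) →
      proj₂ (below y ≤-refl) t′ (b , u , t′b , t′u , (z , nb) , ru) λ (v , (z′ , w , nw , wv) , t′v) →
      nonzero-below y (λ x x<y → below x (m≤n⇒m≤1+n x<y)) t′ b u t′b t′u (z , nb) ru s λ m →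
      full w s λ ws →
      included (decrement ⨾ (symbol (4 + i) ∩ (graph f (suc i) ⨾ S ˘ ⨾ one))) (symbol (4 + i)) step
        (t′ , ((a , ta , b , ba , t′b) , (u , tu , t′u)) , m , v , t′v , w , wv , ws) k

  computes : ∀ {n} (c : Rec n) i → All (Empty ρ) (axioms c i) → ∀ {xs y} → c [ xs ]⇓ y → Computes c i xs y
  computes zer i ax zer⇓ t r k = total-Z t λ (b , tb) → k (b , (t , tb) , tb)
  computes succ i ax (succ⇓ {x}) t (a , u , ta , tu , na , ru) k =
    total-S a λ (b , ab) → k (b , num-suc x na ab , a , ta , ab)
  computes (proj j) i ax {xs} (proj⇓ .j) t r k = proj-computes j xs t r k
  computes (comp f gs) i ax {xs} (comp⇓ zs ds d) t r k =
    comp-computes gs zs xs i (++⁻ˡ (axioms* gs i) ax)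
      (λ j i′ ax′ → computes (lookup gs j) i′ ax′ (ds j)) t r λ (u , ru , tu) →
    computes f (i + size* gs) (++⁻ʳ (axioms* gs i) ax) d u ru λ (b , nb , ub) → k (b , nb , u , tu , ub)
  computes (prec g h) i (base ∷ step ∷ ax) (prec-zero⇓ d) t (a , u , ta , tu , (z , za) , ru) k =
    computes g (suc i) (++⁻ˡ (axioms g (suc i)) ax) d u ru λ (b , nb , ub) → full z b λ zb →
    included ((hd ⨾ Z ˘ ⨾ one) ∩ (tl ⨾ graph g (suc i))) (symbol (4 + i)) base
      ((a , ta , z , za , zb) , (u , tu , ub)) λ tb → k (b , nb , tb)
  computes (prec g h) i (base ∷ step ∷ ax) (prec-suc⇓ d e) t (a , u , ta , tu , (z , a′ , na′ , a′a) , ru) k =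
    -- The lists `t′`, `v` and `w` represent `x ∷ xs`, `r ∷ xs` and `x ∷ r ∷ xs`.
    full a′ u λ (t′ , t′a′ , t′u) →
    computes (prec g h) i (base ∷ step ∷ ax) d t′ (a′ , u , t′a′ , t′u , (z , na′) , ru) λ (r , nr , t′r) →
    full r u λ (v , vr , vu) → full a′ v λ (w , wa′ , wv) →
    computes h (suc i + size g) (++⁻ʳ (axioms g (suc i)) ax) e w
      (a′ , v , wa′ , wv , (z , na′) , r , u , vr , vu , nr , ru) λ (b , nb , wb) →
    included (decrement ⨾ insertValue (symbol (4 + i)) ⨾ graph h (suc i + size g)) (symbol (4 + i)) step
      (t′ , ((a , ta , a′ , a′a , t′a′) , (u , tu , t′u)) ,
       w , ((a′ , t′a′ , wa′) , (u , t′u , v , vu , wv) , (r , t′r , v , vr , wv)) , wb)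
      λ tb → k (b , nb , tb)
  computes (mu f) i (base ∷ step ∷ ax) {xs} (mu⇓ {y = y} v ds d) t r k =
    num-exists y λ (b , nb) → full b t λ (t′ , t′b , t′t) →
    computes f (suc i) ax d t′ (b , t , t′b , t′t , nb , r) λ (c , (s , sc) , t′c) → full s b λ sb →
    nonzero-below f i base step xs y below t′ b t t′b t′t nb r b λ m →
    k (b , nb , t′ , t′t , t′b , m , c , t′c , s , sc , sb)
    where
    at : ∀ j → Computes f (suc i) (toℕ j ∷ xs) (suc (v j))
    at j = computes f (suc i) ax (ds j)
    below : ∀ x → x < y → ∃[ w ] Computes f (suc i) (x ∷ xs) (suc w)
    below x x<y = v (fromℕ< x<y) ,
      subst (λ x → Computes f (suc i) (x ∷ xs) (suc (v (fromℕ< x<y)))) (toℕ-fromℕ< x<y) (at (fromℕ< x<y))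

-- The standard model

nthRelation : List (ℕ → ℕ → Set) → ℕ → ℕ → ℕ → Set
nthRelation []       i       x y = ⊥
nthRelation (R ∷ Rs) zero    x y = R x y
nthRelation (R ∷ Rs) (suc i) x y = nthRelation Rs i x y

intended : List (ℕ → ℕ → Set) → ℕ → ℕ → ℕ → Set
intended Rs 0 t z = z ≡ 0
intended Rs 1 x y = y ≡ suc x
intended Rs 2 t a = a ≡ π₁ t
intended Rs 3 t u = u ≡ π₂ t
intended Rs (suc (suc (suc (suc i)))) x y = nthRelation Rs i x y

module Standard (Rs₀ : List (ℕ → ℕ → Set)) where

  ρ : ℕ → ℕ → ℕ → Set
  ρ = intended Rs₀

  -- A condition on the block of symbols from `4 + i` on, so that a subcode is treated in place
  -- within the symbols of the whole code.
  Interprets : List (ℕ → ℕ → Set) → ℕ → Set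
  Interprets []       i = ⊤
  Interprets (R ∷ Rs) i = (∀ x y → Iff (ρ (4 + i) x y) (R x y)) × Interprets Rs (suc i)

  interprets-++ : ∀ Rs Rs′ i → Interprets (Rs List.++ Rs′) i →
                  Interprets Rs i × Interprets Rs′ (i + length Rs)
  interprets-++ []       Rs′ i ok = tt , subst (Interprets Rs′) (sym (+-identityʳ i)) ok
  interprets-++ (R ∷ Rs) Rs′ i (eq , ok) with interprets-++ Rs Rs′ (suc i) ok
  ... | ok₁ , ok₂ = (eq , ok₁) , subst (Interprets Rs′) (sym (+-suc i (length Rs))) ok₂

  standard-total-Z : Total ρ Z
  standard-total-Z x k = k (0 , refl)

  standard-total-S : Total ρ S
  standard-total-S x k = k (suc x , refl)

  standard-full : Empty ρ (∁ one)
  standard-full a u k = k (pair a u , sym (π₁-pair a u) , sym (π₂-pair a u))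

  standard-numeral : ∀ n {s a} → den ρ (numeral n) s a → a ≡ n
  standard-numeral zero    z            = z
  standard-numeral (suc n) (b , nb , e) = trans e (cong suc (standard-numeral n nb))

  standard-proj : ∀ {n} (j : Fin n) {t y} → den ρ (nth-entry j) t y → y ≡ lookup (vecFrom n t) j
  standard-proj zero    e            = e
  standard-proj (suc j) (u , refl , d) = standard-proj j d

  mutual
    -- The absence of junk in the standard graph: this keeps the query empty and validates the step
    -- axioms.
    standard-graph : ∀ {n} (c : Rec n) i → Interprets (fixpoints c) i →
                     ∀ {t y} → den ρ (graph c i) t y → c [ vecFrom n t ]⇓ y
    standard-graph zer i ok refl = zer⇓
    standard-graph succ i ok (a , refl , refl) = succ⇓
    standard-graph (proj j) i ok d = subst (proj j [ _ ]⇓_) (sym (standard-proj j d)) (proj⇓ j)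
    standard-graph (comp f gs) i ok (u , tu , uy) with interprets-++ (fixpoints* gs) (fixpoints f) i ok
    ... | ok₁ , ok₂ = comp⇓ (vecFrom _ u) (standard-graph* gs i ok₁ tu) (standard-graph f _ ok₂ uy)
    standard-graph (prec g h) i (eq , _) d = proj₁ (eq _ _) d
    standard-graph (mu f) i (eq , ok) (t , refl , refl , m , v , tv , s , refl , _) =
      mu⇓ (λ j → proj₁ (below (toℕ j) (toℕ<n j))) (λ j → proj₂ (below (toℕ j) (toℕ<n j)))
          (standard-graph f (suc i) ok tv)
      where
      below : NonzeroBelow f t (π₁ t)
      below = proj₁ (eq t (π₁ t)) m

    standard-graph* : ∀ {m n} (gs : Vec (Rec n) m) i → Interprets (fixpoints* gs) i →
                      ∀ {t u} → den ρ (graph* gs i) t u →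
                      ∀ j → lookup gs j [ vecFrom n t ]⇓ lookup (vecFrom m u) j
    standard-graph* (g ∷ gs) i ok ((b , tb , refl) , (u′ , tu′ , refl)) j
      with interprets-++ (fixpoints g) (fixpoints* gs) i ok | j
    ... | ok₁ , ok₂ | zero   = standard-graph g i ok₁ tb
    ... | ok₁ , ok₂ | suc j′ = standard-graph* gs (i + size g) ok₂ tu′ j′

  ∖-empty : ∀ R Q → (∀ {x y} → den ρ R x y → den ρ Q x y) → Empty ρ (R ∖ Q)
  ∖-empty R Q R⊆Q x y (r , ¬q) = ¬q (R⊆Q r)

  mutual
    standard-axioms : ∀ {n} (c : Rec n) i → Interprets (fixpoints c) i → All (Empty ρ) (axioms c i)
    standard-axioms zer      i ok = []
    standard-axioms succ     i ok = []
    standard-axioms (proj j) i ok = []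
    standard-axioms (comp f gs) i ok with interprets-++ (fixpoints* gs) (fixpoints f) i ok
    ... | ok₁ , ok₂ = ++⁺ (standard-axioms* gs i ok₁) (standard-axioms f _ ok₂)
    standard-axioms (prec g h) i (eq , ok) with interprets-++ (fixpoints g) (fixpoints h) (suc i) ok
    ... | ok₁ , ok₂ =
      ∖-empty ((hd ⨾ Z ˘ ⨾ one) ∩ (tl ⨾ graph g (suc i))) (symbol (4 + i)) base ∷
      ∖-empty (decrement ⨾ insertValue (symbol (4 + i)) ⨾ graph h (suc i + size g)) (symbol (4 + i)) step ∷
      ++⁺ (standard-axioms g (suc i) ok₁) (standard-axioms h _ ok₂)
      where
      base : ∀ {t y} → den ρ ((hd ⨾ Z ˘ ⨾ one) ∩ (tl ⨾ graph g (suc i))) t y → ρ (4 + i) t y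
      base {t} {y} ((a , a≡ , s , a≡0 , _) , (u , refl , uy)) = proj₂ (eq t y)
        (subst (λ x → prec g h [ x ∷ vecFrom _ (π₂ t) ]⇓ y) (trans (sym a≡0) a≡)
          (prec-zero⇓ (standard-graph g (suc i) ok₁ uy)))
      step : ∀ {t y} → den ρ (decrement ⨾ insertValue (symbol (4 + i)) ⨾ graph h (suc i + size g)) t y →
             ρ (4 + i) t y
      step {t} {y} (u , ((a , a≡ , b , a≡1+b , b≡) , (t′ , t′≡π₂t , t′≡π₂u)) ,
            w , ((c , c≡π₁u , c≡π₁w) , (u′ , u′≡π₂u , v′ , u′≡π₂v′ , v′≡π₂w) , (r , ur , v , r≡π₁v , v≡π₂w)) , wy) =
        proj₂ (eq t y)
          (subst₂ (λ x zs → prec g h [ x ∷ zs ]⇓ y)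
            (trans (cong suc (sym b≡)) (trans (sym a≡1+b) a≡))
            (cong (vecFrom _) (trans (sym t′≡π₂u) t′≡π₂t))
            (prec-suc⇓ (proj₁ (eq u r) ur)
              (subst (λ xs → h [ xs ]⇓ y) args (standard-graph h (suc i + size g) ok₂ wy))))
        where
        args : vecFrom _ w ≡ π₁ u ∷ r ∷ vecFrom _ (π₂ u)
        args = cong₂ _∷_ (trans (sym c≡π₁w) c≡π₁u)
          (cong₂ _∷_ (trans (cong π₁ (sym v≡π₂w)) (sym r≡π₁v))
            (cong (vecFrom _) (trans (cong π₂ (sym v′≡π₂w)) (trans (sym u′≡π₂v′) u′≡π₂u))))
    standard-axioms (mu f) i (eq , ok) =
      ∖-empty (hd ⨾ Z ˘ ⨾ one) (symbol (4 + i)) base ∷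
      ∖-empty (decrement ⨾ (symbol (4 + i) ∩ (graph f (suc i) ⨾ S ˘ ⨾ one))) (symbol (4 + i)) step ∷
      standard-axioms f (suc i) ok
      where
      base : ∀ {t y} → den ρ (hd ⨾ Z ˘ ⨾ one) t y → ρ (4 + i) t y
      base {t} {y} (a , a≡ , s , a≡0 , _) = proj₂ (eq t y)
        λ x x<π₁t → contradiction (subst (x <_) (trans (sym a≡) a≡0) x<π₁t) λ ()
      step : ∀ {t y} → den ρ (decrement ⨾ (symbol (4 + i) ∩ (graph f (suc i) ⨾ S ˘ ⨾ one))) t y → ρ (4 + i) t y
      step {t} {y} (u , ((a , a≡ , b , a≡1+b , b≡) , (t′ , t′≡π₂t , t′≡π₂u)) , m , v , uv , w , v≡1+w , _) =
        proj₂ (eq t y) λ x x<π₁t →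
          subst (λ s → ∃[ v ] f [ x ∷ vecFrom _ s ]⇓ suc v) (trans (sym t′≡π₂u) t′≡π₂t)
            (go x (m≤n⇒m<n∨m≡n (≤-pred (subst (x <_) (trans (sym a≡) (trans a≡1+b (cong suc b≡))) x<π₁t))))
        where
        go : ∀ x → x < π₁ u ⊎ x ≡ π₁ u → ∃[ v ] f [ x ∷ vecFrom _ (π₂ u) ]⇓ suc v
        go x (inj₁ x<)  = proj₁ (eq u y) m x x<
        go x (inj₂ refl) = w , subst (f [ _ ]⇓_) v≡1+w (standard-graph f (suc i) ok uv)

    standard-axioms* : ∀ {m n} (gs : Vec (Rec n) m) i → Interprets (fixpoints* gs) i →
                       All (Empty ρ) (axioms* gs i)
    standard-axioms* []       i ok = []
    standard-axioms* (g ∷ gs) i ok with interprets-++ (fixpoints g) (fixpoints* gs) i ok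
    ... | ok₁ , ok₂ = ++⁺ (standard-axioms g i ok₁) (standard-axioms* gs _ ok₂)

interprets-all : ∀ Rs → Standard.Interprets Rs Rs 0
interprets-all Rs = from-index Rs 0 (λ j x y → id , id)
  where
  open Standard Rs
  from-index : ∀ Rs′ i → (∀ j x y → Iff (ρ (4 + (i + j)) x y) (nthRelation Rs′ j x y)) → Interprets Rs′ i
  from-index []        i iff = tt
  from-index (R ∷ Rs′) i iff =
    (λ x y → subst (λ k → Iff (ρ (4 + k) x y) (R x y)) (+-identityʳ i) (iff 0 x y)) ,
    from-index Rs′ (suc i) (λ j x y →
      subst (λ k → Iff (ρ (4 + k) x y) (nthRelation Rs′ j x y)) (+-suc i j) (iff (suc j) x y))

-- Determinism of evaluation

lookup-injective : ∀ {n} (xs ys : Vec ℕ n) → (∀ j → lookup xs j ≡ lookup ys j) → xs ≡ ys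
lookup-injective []       []       eq = refl
lookup-injective (x ∷ xs) (y ∷ ys) eq = cong₂ _∷_ (eq zero) (lookup-injective xs ys (eq ∘ suc))

-- The two argument lists are only propositionally equal so that the recursive calls of the
-- mu case can use the subderivations as they stand.
⇓-functional : ∀ {n} {c : Rec n} {xs ys y z} → xs ≡ ys → c [ xs ]⇓ y → c [ ys ]⇓ z → y ≡ z
⇓-functional refl zer⇓ zer⇓ = refl
⇓-functional refl succ⇓ succ⇓ = refl
⇓-functional refl (proj⇓ j) (proj⇓ .j) = refl
⇓-functional refl (comp⇓ zs ds d) (comp⇓ zs′ ds′ d′) =
  ⇓-functional (lookup-injective zs zs′ (λ j → ⇓-functional refl (ds j) (ds′ j))) d d′
⇓-functional refl (prec-zero⇓ d) (prec-zero⇓ d′) = ⇓-functional refl d d′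
⇓-functional refl (prec-suc⇓ {x = x} d e) (prec-suc⇓ d′ e′) =
  ⇓-functional (cong (λ r → x ∷ r ∷ _) (⇓-functional refl d d′)) e e′
⇓-functional {xs = xs} refl (mu⇓ {y = y} v ds d) (mu⇓ {y = z} v′ ds′ d′) with <-cmp y z
... | tri≈ _ y≡z _ = y≡z
... | tri< y<z _ _ =
  contradiction (⇓-functional (cong (_∷ xs) (sym (toℕ-fromℕ< y<z))) d (ds′ (fromℕ< y<z))) λ ()
... | tri> _ _ z<y =
  contradiction (⇓-functional (cong (_∷ xs) (toℕ-fromℕ< z<y)) (ds (fromℕ< z<y)) d′) λ ()

-- The reduction

-- Its emptiness says that c maps no list starting with n to 0.
query : Rec 2 → ℕ → Expr
query c n = numeral n ⨾ hd ˘ ⨾ graph c 0 ⨾ Z ˘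

-- On nullary terms `J′` is conjunction.
emptiness : List Expr → Term
emptiness []       = J′ (isTotal Z) (isTotal S)
emptiness (R ∷ Rs) = J′ (isEmpty R) (emptiness Rs)

constraints : Rec 2 → ℕ → List Expr
constraints c n = query c n ∷ ∁ one ∷ axioms c 0

reduction : Rec 2 → ℕ → Term
reduction c n = emptiness (constraints c n)

module _ (𝔄 : Model) where
  open Model 𝔄
  open Semantics 𝔄
  open ExprSemantics 𝔄

  Sem-emptiness : ∀ Rs σ → Sem (emptiness Rs) σ ⇔ (All (Empty rels) Rs × Total rels Z × Total rels S)
  Sem-emptiness [] σ = mk⇔
    (λ s → let z , s′ = to (Sem-J (isTotal Z) (isTotal S) σ) s in
       [] , to (Sem-isTotal Z σ) z , to (Sem-isTotal S σ) s′)
    (λ (_ , z , s) → from (Sem-J (isTotal Z) (isTotal S) σ) (from (Sem-isTotal Z σ) z , from (Sem-isTotal S σ) s))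
  Sem-emptiness (R ∷ Rs) σ = mk⇔
    (λ s → let r , s′ = to (Sem-J (isEmpty R) (emptiness Rs) σ) s
               rs , totals = to (Sem-emptiness Rs σ) s′
           in to (Sem-isEmpty R rest) r ∷ rs , totals)
    (λ { (r ∷ rs , totals) → from (Sem-J (isEmpty R) (emptiness Rs) σ)
           (from (Sem-isEmpty R rest) r , from (Sem-emptiness Rs σ) (rs , totals)) })
    where
    rest : ℕ → Dom
    rest i = σ (ar (emptiness Rs) + i)

standardModel : Rec 2 → Model
standardModel c = record { Dom = ℕ ; element = 0 ; interp = interp }
  where
  interp : (k i : ℕ) → AD ℕ k
  interp 2 i (x ∷ y ∷ []) = intended (fixpoints c) i x y
  interp _ _ _            = ⊥

module _ (c : Rec 2) (n : ℕ) where

  reduction-satisfiable : (∀ m → ¬ c [ n ∷ m ∷ [] ]⇓ 0) → Satisfiable (reduction c n)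
  reduction-satisfiable nonzero = standardModel c ,
    from (≢∅⇔¬¬Sem (reduction c n)) λ none → none (const 0 ,
      from (Sem-emptiness (standardModel c) (constraints c n) _)
        ( query-empty ∷ standard-full ∷ standard-axioms c 0 (interprets-all (fixpoints c))
        , standard-total-Z , standard-total-S))
    where
    open Semantics (standardModel c)
    open Standard (fixpoints c)
    query-empty : Empty ρ (query c n)
    query-empty s s′ (a , na , t , refl , z , tz , refl) with standard-numeral n na
    ... | refl = nonzero _ (standard-graph c 0 (interprets-all (fixpoints c)) tz)

  reduction-unsatisfiable : ∀ m → c [ n ∷ m ∷ [] ]⇓ 0 → ¬ Satisfiable (reduction c n)
  reduction-unsatisfiable m zero⇓ (𝔄 , ≢∅) = to (≢∅⇔¬¬Sem (reduction c n)) ≢∅ λ (σ , s) →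
    refute (to (Sem-emptiness 𝔄 (constraints c n) σ) s)
    where
    open Model 𝔄
    open Semantics 𝔄
    open ExprSemantics 𝔄
    refute : ¬ (All (Empty rels) (constraints c n) × Total rels Z × Total rels S)
    refute (query-empty ∷ full ∷ ax , total-Z , total-S) =
      rep-exists (n ∷ m ∷ []) λ { (t , r@(a , _ , ta , _ , (s , na) , _)) →
      computes c 0 ax zero⇓ t r λ (b , (s′ , zb) , tb) →
      query-empty s s′ (a , na , t , ta , b , tb , zb) }
      where open Adequacy rels element total-Z total-S full

-- Computability of the reduction

-- The record keeps F rigid: unfolding nested codes during unification is infeasible.
record CodeMap (F : Term → Term) : Set where
  constructor codeMap
  field
    onCodes    : ℕ → ℕ
    onCodes#   : Computable₁ onCodes
    onCodes-⌜⌝ : ∀ T → onCodes ⌜ T ⌝ ≡ ⌜ F T ⌝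

open CodeMap

tag : ℕ → ℕ → ℕ
tag t x = t + 6 * x

tag-computable : ∀ t → Computable₁ (tag t)
tag-computable t = curry₁ (lit t ⊕ lit 6 ⊛ x₀)

taggedMap : ∀ {F} (c : Term → Term) t → (∀ T → tag t ⌜ T ⌝ ≡ ⌜ c T ⌝) → CodeMap F → CodeMap (λ T → c (F T))
taggedMap {F} c t code (codeMap f f# eq) = codeMap (λ x → tag t (f x))
  (curry₁ (app₁ (tag-computable t) (app₁ f# x₀))) (λ T → trans (cong (tag t) (eq T)) (code (F T)))

pMap : ∀ {F} → CodeMap F → CodeMap (λ T → p′ (F T))
pMap = taggedMap p′ 1 (λ T → refl)

IMap : ∀ {F} → CodeMap F → CodeMap (λ T → I′ (F T))
IMap = taggedMap I′ 2 (λ T → refl)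

¬Map : ∀ {F} → CodeMap F → CodeMap (λ T → ¬′ (F T))
¬Map = taggedMap ¬′ 3 (λ T → refl)

∃Map : ∀ {F} → CodeMap F → CodeMap (λ T → ∃′ (F T))
∃Map = taggedMap ∃′ 5 (λ T → refl)

JMap : ∀ {F} → CodeMap F → ∀ U → CodeMap (λ T → J′ (F T) U)
JMap (codeMap f f# eq) U = codeMap (λ x → tag 4 (pair (f x) ⌜ U ⌝))
  (curry₁ (app₁ (tag-computable 4) (app₂ pair-computable (app₁ f# x₀) (lit ⌜ U ⌝))))
  (λ T → cong (λ x → tag 4 (pair x ⌜ U ⌝)) (eq T))

idMap : CodeMap (λ T → T)
idMap = codeMap (λ x → x) (curry₁ x₀) (λ T → refl)

-- The shape of `term (R ⨾ Q)` as a function of `term R`, with `U` for `term Q`.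
composeMap : ∀ U → CodeMap (λ T → p′ (∃′ (I′ (p′ (J′ T U)))))
composeMap U = pMap (∃Map (IMap (pMap (JMap idMap U))))

numeral-computable : Computable₁ (λ n → ⌜ term (numeral n) ⌝)
numeral-computable = curry₁ (primitive-recursion (lit ⌜ term Z ⌝)
  (app₁ (onCodes# (composeMap (term S))) x₁) (λ _ → refl)
  (λ n _ → onCodes-⌜⌝ (composeMap (term S)) (term (numeral n))))

image-computable : ∀ {F} → CodeMap F → ∀ {T : ℕ → Term} → Computable₁ (λ n → ⌜ T n ⌝) →
                   Computable₁ (λ n → ⌜ F (T n) ⌝)
image-computable F# {T} T# = curry₁ (computable-≗ (λ xs → onCodes-⌜⌝ F# (T (lookup xs zero)))
  (app₁ (onCodes# F#) (app₁ T# x₀)))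

-- The input `n` enters only through `numeral n`, the left factor of the query; around its code
-- stand fixed constructors and constants.
reduction-computable : ∀ c → Computable₁ (λ n → ⌜ reduction c n ⌝)
reduction-computable c = image-computable
  (JMap (¬Map (∃Map (∃Map (composeMap (term (hd ˘ ⨾ graph c 0 ⨾ Z ˘)))))) (emptiness (∁ one ∷ axioms c 0)))
  {λ n → term (numeral n)} numeral-computable

computable₁⇒ : ∀ {f} → Computable₁ f → Computable (f ∘ head)
computable₁⇒ (c , c⇓) = c , λ { (x ∷ []) → c⇓ x }

Π₁⁰⇒≤ₘSAT : ∀ {ℓ} (B : Pred ℕ ℓ) → Π₁⁰ B → B ≤ₘ SAT
Π₁⁰⇒≤ₘSAT B (R , (χ , (c , c⇓) , χ-decides) , B⇔R) =
  reduce (λ n → ⌜ reduction c n ⌝) (λ n → refl) (reduction-computable c)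
  where
  nonzero : ∀ n → (∀ m → R (n ∷ m ∷ [])) → ∀ m → ¬ c [ n ∷ m ∷ [] ]⇓ 0
  nonzero n r m c⇓0 with χ-decides (n ∷ m ∷ [])
  ... | inj₁ (χ≡1 , _) = contradiction (trans (sym χ≡1) (⇓-functional refl (c⇓ _) c⇓0)) λ ()
  ... | inj₂ (_ , ¬r)  = ¬r (r m)
  holds : ∀ n m → Satisfiable (reduction c n) → R (n ∷ m ∷ [])
  holds n m sat with χ-decides (n ∷ m ∷ [])
  ... | inj₁ (_ , r)   = r
  -- Off `R` the code `c` has value 0, exactly what the query forbids.
  ... | inj₂ (χ≡0 , _) =
    contradiction sat (reduction-unsatisfiable c n m (subst (c [ n ∷ m ∷ [] ]⇓_) χ≡0 (c⇓ _)))
  -- The code is abstracted to a variable f so that it is never unfolded.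
  reduce : (f : ℕ → ℕ) → (∀ n → f n ≡ ⌜ reduction c n ⌝) → Computable₁ f → B ≤ₘ SAT
  reduce f f≡ f# = f , computable₁⇒ f# , λ n → mk⇔
    (λ b → reduction c n , sym (f≡ n) , reduction-satisfiable c n (nonzero n (to (B⇔R n) b)))
    (λ (T , eq , sat) → from (B⇔R n) λ m →
      holds n m (subst Satisfiable (⌜⌝-injective {T} {reduction c n} (trans eq (f≡ n))) sat))

theorem6p4 : Π₁⁰-Complete SAT
theorem6p4 = SAT-Π₁⁰ , Π₁⁰⇒≤ₘSAT
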